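{- Let $P=(G,R)$ be a partial field and let $0 \le r \le n$ be integers, $E=[n]$, $N=\binom{n}{r}-1$. For a point $p=(p_J)_{J \in \binom{E}{r}} \in \mathbf{P}^N(P)$ the following are equivalent: \begin{enumerate} \item There exists an $r \times n$ matrix $A$ with entries in $P$ such that (for a suitable choice of homogeneous coordinates of $p$) $p_J = \det(A_J)$ for all $J \in \binom{E}{r}$. \item $p$ satisfies the Plücker equations, i.e. $p$ is the Plücker vector of a strong $P$-matroid. \item $p$ is the Plücker vector of a weak $P$-matroid. \end{enumerate}
   Context: A partial field $P=(G,R)$ consists of a commutative ring $R$ with $1$ and a subgroup $G$ of the unit group of $R$ with $-1 \in G$; the elements of $P$ are the elements of $G \cup \{0\}$. $\mathbf{P}^N(P)$ denotes the set of nonzero vectors $(p_J)$ with all $p_J \in G\cup\{0\}$, modulo rescaling by elements of $G$; equations are interpreted in $R$. For an $r\times n$ matrix $A$ with columns indexed by $E$, $A_J$ is the $r \times r$ submatrix with column set $J$. $\binom{E}{r}$ is the set of $r$-subsets of $E$; set $X_J=0$ whenever $|J|<r$. For $S \in \binom{E}{r+1}$, $T \in \binom{E}{r-1}$, $x \in S$, let $\mathrm{sign}(x;S,T)=(-1)^m$, where $m$ is the number of $s \in S$ with $s>x$ plus the number of $t\in T$ with $t>x$. The Plücker equations are $\sum_{x\in S}\mathrm{sign}(x;S,T)X_{S\setminus\{x\}}X_{T\cup\{x\}}=0$ for all such $S,T$; the $3$-term Plücker equations are those with $|S\setminus T|=3$. A strong $P$-matroid of rank $r$ on $E$ is a point of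 $\mathbf{P}^N(P)$ satisfying the Plücker equations. A weak $P$-matroid of rank $r$ on $E$ is a point $p\in\mathbf{P}^N(P)$ satisfying the $3$-term Plücker equations such that $\{J : p_J \ne 0\}$ is the set of bases of a matroid of rank $r$ on $E$. -}

module Defs where

open import Level using (Level; _⊔_)
open import Algebra.Bundles using (CommutativeRing)
open import Data.Nat as ℕ using (ℕ; zero; suc; _≟_)
open import Data.Fin as Fin using (Fin; zero; suc; punchIn; _<?_)
open import Data.Fin.Subset using (Subset; inside; outside; ∣_∣; _∈_; _∉_; _∩_; _∪_; _─_; _-_; ⁅_⁆; ∁)
open import Data.Fin.Subset.Properties using (_∈?_)
open import Data.Vec using (Vec; []; _∷_; tabulate)
open import Data.Bool using (true; false)
open import Data.Product using (Σ; ∃; _×_; _,_)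
open import Data.Sum using (_⊎_)
open import Relation.Nullary using (¬_; yes; no; does)
open import Relation.Binary.PropositionalEquality using (_≡_; subst; sym)

record PartialField (c ℓ g : Level) : Set (Level.suc (c ⊔ ℓ ⊔ g)) where
  field
    R : CommutativeRing c ℓ
  open CommutativeRing R public
    using (Carrier; _≈_; _+_; _*_; -_; 0#; 1#)
  field
    G          : Carrier → Set g
    G-resp     : ∀ {x y} → x ≈ y → G x → G y
    G-one      : G 1#
    G-minusOne : G (- 1#)
    G-mul      : ∀ {x y} → G x → G y → G (x * y)
    G-inv      : ∀ {x} → G x → Σ Carrier (λ y → G y × (x * y ≈ 1#))

  InP : Carrier → Set (ℓ ⊔ g)
  InP x = G x ⊎ x ≈ 0#

module PF {c ℓ g} (P : PartialField c ℓ g) where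
  open PartialField P using (Carrier; _≈_; _+_; _*_; -_; 0#; 1#; G; InP)

  sumFin : ∀ {k} → (Fin k → Carrier) → Carrier
  sumFin {zero}  f = 0#
  sumFin {suc k} f = f zero + sumFin (λ i → f (suc i))

  signPow : ℕ → Carrier
  signPow zero    = 1#
  signPow (suc m) = - signPow m

  det : ∀ {k} → (Fin k → Fin k → Carrier) → Carrier
  det {zero}  A = 1#
  det {suc k} A =
    sumFin (λ j → signPow (Fin.toℕ j) * (A zero j * det (λ i l → A (suc i) (punchIn j l))))

  elems : ∀ {n} (J : Subset n) → Fin ∣ J ∣ → Fin n
  elems (true  ∷ J) zero    = zero
  elems (true  ∷ J) (suc i) = suc (elems J i)
  elems (false ∷ J) i       = suc (elems J i)

  subMatrix : ∀ {r n} → (Fin r → Fin n → Carrier) → (J : Subset n) → ∣ J ∣ ≡ r →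
              Fin r → Fin r → Carrier
  subMatrix A J eq i k = A i (elems J (subst Fin (sym eq) k))

  X : ∀ {n} (r : ℕ) → (Subset n → Carrier) → Subset n → Carrier
  X r p J with ∣ J ∣ ≟ r
  ... | yes _ = p J
  ... | no  _ = 0#

  above : ∀ {n} → Fin n → Subset n
  above x = tabulate (λ s → does (x <? s))

  sign : ∀ {n} → Fin n → Subset n → Subset n → Carrier
  sign x S T = signPow (∣ S ∩ above x ∣ ℕ.+ ∣ T ∩ above x ∣)

  pluckerSum : ∀ {n} (r : ℕ) → (Subset n → Carrier) → Subset n → Subset n → Carrier
  pluckerSum r p S T =
    sumFin (λ x → term x (x ∈? S))
    where
    term : ∀ x → _ → Carrier
    term x (yes _) = sign x S T * (X r p (S - x) * X r p (T ∪ ⁅ x ⁆))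
    term x (no  _) = 0#

  -- p is a representative of a point of P^N(P): all coordinates X_J (|J| = r)
  -- lie in P, and not all of them are zero
  IsPoint : ∀ {n} (r : ℕ) → (Subset n → Carrier) → Set (ℓ ⊔ g)
  IsPoint r p =
    (∀ J → ∣ J ∣ ≡ r → InP (p J)) × Σ (Subset _) (λ J → (∣ J ∣ ≡ r) × ¬ (p J ≈ 0#))

  Plucker : ∀ {n} (r : ℕ) → (Subset n → Carrier) → Set ℓ
  Plucker r p = ∀ S T → ∣ S ∣ ≡ suc r → suc ∣ T ∣ ≡ r → pluckerSum r p S T ≈ 0#

  Plucker3 : ∀ {n} (r : ℕ) → (Subset n → Carrier) → Set ℓ
  Plucker3 r p = ∀ S T → ∣ S ∣ ≡ suc r → suc ∣ T ∣ ≡ r → ∣ S ─ T ∣ ≡ 3 →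
                 pluckerSum r p S T ≈ 0#

  StrongPMatroid : ∀ {n} (r : ℕ) → (Subset n → Carrier) → Set (ℓ ⊔ g)
  StrongPMatroid r p = IsPoint r p × Plucker r p

  Representable : ∀ {n} (r : ℕ) → (Subset n → Carrier) → Set (c ⊔ ℓ ⊔ g)
  Representable {n} r p =
    Σ (Fin r → Fin n → Carrier) λ A →
      (∀ i j → InP (A i j)) ×
      Σ Carrier (λ a → G a × (∀ J (eq : ∣ J ∣ ≡ r) → a * p J ≈ det (subMatrix A J eq)))

record IsMatroidBases {b} (n r : ℕ) (𝓑 : Subset n → Set b) : Set b where
  field
    nonempty : Σ (Subset n) 𝓑
    rank     : ∀ B → 𝓑 B → ∣ B ∣ ≡ r
    exchange : ∀ B₁ B₂ → 𝓑 B₁ → 𝓑 B₂ → ∀ x → x ∈ B₁ → x ∉ B₂ →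
               Σ (Fin n) (λ y → y ∈ B₂ × y ∉ B₁ × 𝓑 ((B₁ - x) ∪ ⁅ y ⁆))

module PF₂ {c ℓ g} (P : PartialField c ℓ g) where
  open PartialField P using (Carrier; _≈_; 0#)
  open PF P

  support : ∀ {n} (r : ℕ) → (Subset n → Carrier) → Subset n → Set ℓ
  support r p J = (∣ J ∣ ≡ r) × ¬ (p J ≈ 0#)

  WeakPMatroid : ∀ {n} (r : ℕ) → (Subset n → Carrier) → Set (ℓ ⊔ g)
  WeakPMatroid {n} r p = IsPoint r p × Plucker3 r p × IsMatroidBases n r (support r p)

{-# OPTIONS --safe #-}
module Submission where

-- Functions on subsets of [n] are elements of the exterior algebra; the vector of
-- maximal minors of A is the wedge q of the rows of A. The operator
-- Pl = Σₓ (eₓ ∧) ⊗ ιₓ, whose value at p ⊗ p is the left-hand side of the Plücker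
-- equations up to sign, anticommutes with a ∧ on the left factor and anticommutes
-- with a ∧ on the right factor up to a ∧ on the left factor. As a ∧ a = 0, it
-- kills q ⊗ q, so representable vectors are strong. For S = B₂ ∪ {x} and
-- T = B₁ \ {x} the Plücker equation is basis exchange, so strong vectors are weak.
-- Given a weak p and a basis B, the coordinates p(B \ {b} ∪ {x}) determine a
-- matrix whose vector of minors q agrees (up to a scalar) with p at distance at most
-- one from B. Larger distances follow by induction: fix c in J \ B. If no exchange of
-- c for an element of B leads to a basis, then p(J) = 0 by basis exchange and
-- q(J) = 0 by expansion. Otherwise exchange a second element; the 3-term
-- equation through the basis so reached determines both p(J) and q(J).

open import Defs
open import Algebra.Bundles using (CommutativeRing; RawRing)
import Algebra.Properties.AbelianGroup as AbelianGroupProperties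
import Algebra.Properties.Ring as RingProperties
import Algebra.Properties.Semiring.Mult as SemiringMult
import Algebra.Solver.Ring as RingSolver
open import Algebra.Solver.Ring.AlmostCommutativeRing
  using (fromCommutativeRing; _-Raw-AlmostCommutative⟶_)
open import Data.Bool using (true; false)
open import Data.Fin using (Fin; zero; suc; punchIn; punchOut; cast; toℕ)
open import Data.Fin.Properties
  using (_≟_; suc-injective; punchInᵢ≢i; punchIn-punchOut; punchIn-injective; cast-is-id; subst-is-cast; toℕ-cast)
open import Data.Fin.Subset using (Subset; ∣_∣; _∈_; _∉_; _∩_; _∪_; _─_; _-_; ⁅_⁆)
open import Data.Fin.Subset.Properties using (p⊆q⇒∣p∣≤∣q∣; _∈?_; ∪-identityʳ; p─⊥≡p)
open import Data.Maybe using (Maybe; just; nothing)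
open import Data.Nat as ℕ using (ℕ; zero; suc; _≤_)
import Data.Nat.Properties as ℕₚ
open import Data.Product using (Σ; _×_; _,_; proj₁; proj₂)
open import Data.Sum using (_⊎_; inj₁; inj₂)
open import Data.Vec using ([]; _∷_; lookup; _[_]≔_; tabulate)
open import Data.Vec.Properties using ([]=⇒lookup; lookup⇒[]=; lookup∘update; lookup∘update′)
open import Function using (_∘_)
open import Function.Bundles using (_⇔_; mk⇔)
open import Relation.Binary.PropositionalEquality as ≡ using (_≡_; _≢_)
open import Relation.Binary.PropositionalEquality.Properties using (subst-injective)
import Relation.Binary.Reasoning.Setoid as SetoidReasoning
open import Relation.Nullary using (yes; no; contradiction; ¬_)

-- Ring arithmetic with integer coefficients.

-- The ring solver needs coefficients with a decidable zero test in order to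
-- cancel x - x; the pair (a , b) stands for the integer a - b.
module IntegerSolver {c ℓ} (R : CommutativeRing c ℓ) where
  open CommutativeRing R
  open AbelianGroupProperties +-abelianGroup using (⁻¹-∙-comm; ⁻¹-involutive; ε⁻¹≈ε)
  open RingProperties ring using (-‿distribˡ-*; -‿distribʳ-*)
  open SemiringMult semiring using (×-homo-+; ×1-homo-*) renaming (_×_ to _·_)
  open SetoidReasoning setoid

  differences : RawRing _ _
  differences = record
    { Carrier = ℕ × ℕ
    ; _≈_ = _≡_
    ; _+_ = λ (a , b) (c , d) → a ℕ.+ c , b ℕ.+ d
    ; _*_ = λ (a , b) (c , d) → a ℕ.* c ℕ.+ b ℕ.* d , a ℕ.* d ℕ.+ b ℕ.* c
    ; -_  = λ (a , b) → b , a
    ; 0#  = 0 , 0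
    ; 1#  = 1 , 0
    }

  private
    ⟦_⟧ : ℕ × ℕ → Carrier
    ⟦ a , b ⟧ = a · 1# + - (b · 1#)

    interchange : ∀ u v x y → (u + v) + (x + y) ≈ (u + x) + (v + y)
    interchange u v x y = begin
      (u + v) + (x + y) ≈⟨ +-assoc u v _ ⟩
      u + (v + (x + y)) ≈⟨ +-congˡ (+-assoc v x y) ⟨
      u + ((v + x) + y) ≈⟨ +-congˡ (+-congʳ (+-comm v x)) ⟩
      u + ((x + v) + y) ≈⟨ +-congˡ (+-assoc x v y) ⟩
      u + (x + (v + y)) ≈⟨ +-assoc u x _ ⟨
      (u + x) + (v + y) ∎

    +-homo : ∀ x y → ⟦ RawRing._+_ differences x y ⟧ ≈ ⟦ x ⟧ + ⟦ y ⟧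
    +-homo (a , b) (c , d) = begin
      (a ℕ.+ c) · 1# + - ((b ℕ.+ d) · 1#)
        ≈⟨ +-cong (×-homo-+ 1# a c) (-‿cong (×-homo-+ 1# b d)) ⟩
      (a · 1# + c · 1#) + - (b · 1# + d · 1#)
        ≈⟨ +-congˡ (sym (⁻¹-∙-comm _ _)) ⟩
      (a · 1# + c · 1#) + (- (b · 1#) + - (d · 1#))
        ≈⟨ interchange _ _ _ _ ⟩
      ⟦ a , b ⟧ + ⟦ c , d ⟧ ∎

    *-homo : ∀ x y → ⟦ RawRing._*_ differences x y ⟧ ≈ ⟦ x ⟧ * ⟦ y ⟧
    *-homo (a , b) (c , d) = begin
      (a ℕ.* c ℕ.+ b ℕ.* d) · 1# + - ((a ℕ.* d ℕ.+ b ℕ.* c) · 1#)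
        ≈⟨ +-cong (homo a c b d) (-‿cong (homo a d b c)) ⟩
      (A * C + B * D) + - (A * D + B * C)
        ≈⟨ +-congˡ (⁻¹-∙-comm _ _) ⟨
      (A * C + B * D) + (- (A * D) + - (B * C))
        ≈⟨ +-congˡ (+-comm _ _) ⟩
      (A * C + B * D) + (- (B * C) + - (A * D))
        ≈⟨ interchange _ _ _ _ ⟩
      (A * C + - (B * C)) + (B * D + - (A * D))
        ≈⟨ +-cong (+-congˡ (-‿distribˡ-* B C)) (+-comm _ _) ⟩
      (A * C + - B * C) + (- (A * D) + B * D)
        ≈⟨ +-cong (sym (distribʳ C A (- B))) (+-cong (-‿distribʳ-* A D) lemma) ⟩
      (A + - B) * C + (A * - D + - B * - D)
        ≈⟨ +-congˡ (distribʳ (- D) A (- B)) ⟨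
      (A + - B) * C + (A + - B) * - D
        ≈⟨ distribˡ _ C (- D) ⟨
      ⟦ a , b ⟧ * ⟦ c , d ⟧ ∎
      where
      A = a · 1#
      B = b · 1#
      C = c · 1#
      D = d · 1#
      homo : ∀ i j k l → (i ℕ.* j ℕ.+ k ℕ.* l) · 1# ≈ i · 1# * j · 1# + k · 1# * l · 1#
      homo i j k l = trans (×-homo-+ 1# (i ℕ.* j) (k ℕ.* l)) (+-cong (×1-homo-* i j) (×1-homo-* k l))
      lemma : B * D ≈ - B * - D
      lemma = begin
        B * D         ≈⟨ ⁻¹-involutive _ ⟨
        - - (B * D)   ≈⟨ -‿cong (-‿distribʳ-* B D) ⟩
        - (B * - D)   ≈⟨ -‿distribˡ-* B (- D) ⟩
        - B * - D     ∎

    morphism : differences -Raw-AlmostCommutative⟶ fromCommutativeRing R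
    morphism = record
      { ⟦_⟧    = ⟦_⟧
      ; +-homo = +-homo
      ; *-homo = *-homo
      ; -‿homo = λ (a , b) → begin
          b · 1# + - (a · 1#)       ≈⟨ +-comm _ _ ⟩
          - (a · 1#) + b · 1#       ≈⟨ +-congˡ (⁻¹-involutive _) ⟨
          - (a · 1#) + - - (b · 1#) ≈⟨ ⁻¹-∙-comm _ _ ⟩
          - ⟦ a , b ⟧               ∎
      ; 0-homo = -‿inverseʳ 0#
      ; 1-homo = trans (+-cong (+-identityʳ 1#) ε⁻¹≈ε) (+-identityʳ 1#)
      }

    -- Pairs are compared by cross addition, as differences: `x - x` produces the coefficient
    -- `(1 , 1)`, which plain equality would not identify with `(0 , 0)`.
    coefficient≟ : ∀ x y → Maybe (⟦ x ⟧ ≈ ⟦ y ⟧)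
    coefficient≟ (a , b) (c , d) with a ℕ.+ d ℕ.≟ c ℕ.+ b
    ... | no  _  = nothing
    ... | yes eq = just (begin
      A + - B                     ≈⟨ +-identityʳ _ ⟨
      (A + - B) + 0#              ≈⟨ +-congˡ (-‿inverseʳ D) ⟨
      (A + - B) + (D + - D)       ≈⟨ interchange _ _ _ _ ⟩
      (A + D) + (- B + - D)       ≈⟨ +-congʳ (×-homo-+ 1# a d) ⟨
      (a ℕ.+ d) · 1# + (- B + - D) ≡⟨ ≡.cong (λ z → z · 1# + (- B + - D)) eq ⟩
      (c ℕ.+ b) · 1# + (- B + - D) ≈⟨ +-cong (×-homo-+ 1# c b) (+-comm _ _) ⟩
      (C + B) + (- D + - B)       ≈⟨ interchange _ _ _ _ ⟩
      (C + - D) + (B + - B)       ≈⟨ +-congˡ (-‿inverseʳ B) ⟩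
      (C + - D) + 0#              ≈⟨ +-identityʳ _ ⟩
      C + - D                     ∎)
      where
      A = a · 1#
      B = b · 1#
      C = c · 1#
      D = d · 1#

  open RingSolver differences (fromCommutativeRing R) morphism coefficient≟ public
    using (solve; _:=_; _:+_; _:*_; :-_)

-- Finite sums: splitting off one or two summands.

module FiniteSums {c ℓ g} (P : PartialField c ℓ g) where
  open CommutativeRing (PartialField.R P) hiding (zero)
  open PF P using (sumFin)
  open SetoidReasoning setoid
  open IntegerSolver (PartialField.R P)
  open AbelianGroupProperties +-abelianGroup using (⁻¹-∙-comm; ε⁻¹≈ε; ∙-cancelʳ)

  sum-cong : ∀ {k} {f g : Fin k → Carrier} → (∀ i → f i ≈ g i) → sumFin f ≈ sumFin g
  sum-cong {zero}  eq = refl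
  sum-cong {suc k} eq = +-cong (eq zero) (sum-cong (eq ∘ suc))

  sum-0 : ∀ {k} {f : Fin k → Carrier} → (∀ i → f i ≈ 0#) → sumFin f ≈ 0#
  sum-0 {zero}  eq = refl
  sum-0 {suc k} eq = trans (+-cong (eq zero) (sum-0 (eq ∘ suc))) (+-identityˡ 0#)

  sum-neg : ∀ {k} (f : Fin k → Carrier) → sumFin (λ i → - f i) ≈ - sumFin f
  sum-neg {zero}  f = sym ε⁻¹≈ε
  sum-neg {suc k} f = trans (+-congˡ (sum-neg (f ∘ suc))) (⁻¹-∙-comm _ _)

  sum-punch : ∀ {k} (f : Fin (suc k) → Carrier) i → sumFin f ≈ f i + sumFin (f ∘ punchIn i)
  sum-punch f zero = refl
  sum-punch {suc k} f (suc i) = begin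
    f zero + sumFin (f ∘ suc)
      ≈⟨ +-congˡ (sum-punch (f ∘ suc) i) ⟩
    f zero + (f (suc i) + sumFin (f ∘ suc ∘ punchIn i))
      ≈⟨ solve 3 (λ x y z → x :+ (y :+ z) := y :+ (x :+ z)) refl _ _ _ ⟩
    f (suc i) + (f zero + sumFin (f ∘ suc ∘ punchIn i)) ∎

  -- The summands off `i` cancel from both totals. This is how a single product of coordinates is
  -- extracted from a Plücker equation.
  sum-isolate : ∀ {k} {f g : Fin k → Carrier} i → sumFin f ≈ sumFin g →
                (∀ j → j ≢ i → f j ≈ g j) → f i ≈ g i
  sum-isolate {suc k} {f} {g} i eq others =
    ∙-cancelʳ (sumFin (f ∘ punchIn i)) _ _ (begin
      f i + sumFin (f ∘ punchIn i) ≈⟨ sum-punch f i ⟨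
      sumFin f                     ≈⟨ eq ⟩
      sumFin g                     ≈⟨ sum-punch g i ⟩
      g i + sumFin (g ∘ punchIn i) ≈⟨ +-congˡ (sum-cong (λ j → others _ (punchInᵢ≢i i j))) ⟨
      g i + sumFin (f ∘ punchIn i) ∎)

  sum-single : ∀ {k} {f : Fin k → Carrier} i → (∀ j → j ≢ i → f j ≈ 0#) → sumFin f ≈ f i
  sum-single {suc k} {f} i others = begin
    sumFin f                     ≈⟨ sum-punch f i ⟩
    f i + sumFin (f ∘ punchIn i) ≈⟨ +-congˡ (sum-0 (λ j → others _ (punchInᵢ≢i i j))) ⟩
    f i + 0#                     ≈⟨ +-identityʳ _ ⟩
    f i                          ∎

  sum-pair : ∀ {k} {f : Fin k → Carrier} {i j} → i ≢ j →
             (∀ l → l ≢ i → l ≢ j → f l ≈ 0#) → sumFin f ≈ f i + f j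
  sum-pair {suc k} {f} {i} {j} i≢j others = begin
    sumFin f                     ≈⟨ sum-punch f i ⟩
    f i + sumFin (f ∘ punchIn i) ≈⟨ +-congˡ (sum-single j′ λ l l≢j′ → others _ (punchInᵢ≢i i l)
                                      λ eq → l≢j′ (punchIn-injective i l j′ (≡.trans eq (≡.sym eq′)))) ⟩
    f i + f (punchIn i j′)       ≡⟨ ≡.cong (λ x → f i + f x) eq′ ⟩
    f i + f j                    ∎
    where
    j′ = punchOut i≢j
    eq′ = punchIn-punchOut i≢j

-- The exterior algebra and the Plücker operator.

module Exterior {c ℓ g} (P : PartialField c ℓ g) where
  open CommutativeRing (PartialField.R P) hiding (zero)
  open SetoidReasoning setoid
  open IntegerSolver (PartialField.R P)
  open RingProperties ring using (-‿distribʳ-*)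
  open AbelianGroupProperties +-abelianGroup using (⁻¹-∙-comm; ε⁻¹≈ε; inverseʳ-unique)

  private variable n : ℕ

  -- A function on subsets is read as an element of the exterior algebra of
  -- Carrier^n, and W a f is the product a ∧ f.
  W : (Fin n → Carrier) → (Subset n → Carrier) → Subset n → Carrier
  W a f []          = 0#
  W a f (false ∷ J) = W (a ∘ suc) (f ∘ (false ∷_)) J
  W a f (true ∷ J)  = a zero * f (false ∷ J) + - W (a ∘ suc) (f ∘ (true ∷_)) J

  W-cong : ∀ (a : Fin n → Carrier) {f g} → (∀ J → f J ≈ g J) → ∀ J → W a f J ≈ W a g J
  W-cong a eq []          = refl
  W-cong a eq (false ∷ J) = W-cong _ (eq ∘ _) J
  W-cong a eq (true ∷ J)  = +-cong (*-congˡ (eq _)) (-‿cong (W-cong _ (eq ∘ _) J))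

  W-+ : ∀ (a : Fin n → Carrier) f g J → W a (λ K → f K + g K) J ≈ W a f J + W a g J
  W-+ a f g []          = sym (+-identityˡ 0#)
  W-+ a f g (false ∷ J) = W-+ _ _ _ J
  W-+ a f g (true ∷ J)  = begin
    a zero * (f (false ∷ J) + g (false ∷ J)) + - W _ (λ K → f (true ∷ K) + g (true ∷ K)) J
      ≈⟨ +-congˡ (-‿cong (W-+ _ _ _ J)) ⟩
    _ ≈⟨ solve 5 (λ a x y u v → a :* (x :+ y) :+ :- (u :+ v)
                              := (a :* x :+ :- u) :+ (a :* y :+ :- v)) refl _ _ _ _ _ ⟩
    W a f (true ∷ J) + W a g (true ∷ J) ∎

  W-* : ∀ (a : Fin n → Carrier) k f J → W a (λ K → k * f K) J ≈ k * W a f J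
  W-* a k f []          = sym (zeroʳ k)
  W-* a k f (false ∷ J) = W-* _ k _ J
  W-* a k f (true ∷ J)  = begin
    a zero * (k * f (false ∷ J)) + - W _ (λ K → k * f (true ∷ K)) J
      ≈⟨ +-congˡ (-‿cong (W-* _ k _ J)) ⟩
    _ ≈⟨ solve 4 (λ a k x u → a :* (k :* x) :+ :- (k :* u)
                            := k :* (a :* x :+ :- u)) refl _ _ _ _ ⟩
    k * W a f (true ∷ J) ∎

  W-neg : ∀ (a : Fin n → Carrier) f J → W a (λ K → - f K) J ≈ - W a f J
  W-neg a f []          = sym ε⁻¹≈ε
  W-neg a f (false ∷ J) = W-neg _ _ J
  W-neg a f (true ∷ J)  = begin
    a zero * - f (false ∷ J) + - W _ (λ K → - f (true ∷ K)) J
      ≈⟨ +-congˡ (-‿cong (W-neg _ _ J)) ⟩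
    _ ≈⟨ solve 3 (λ a x u → a :* (:- x) :+ :- (:- u) := :- (a :* x :+ :- u)) refl _ _ _ ⟩
    - W a f (true ∷ J) ∎

  W-0 : ∀ (a : Fin n → Carrier) {f} → (∀ J → f J ≈ 0#) → ∀ J → W a f J ≈ 0#
  W-0 a {f} eq J = begin
    W a f J              ≈⟨ W-cong a (λ K → trans (eq K) (sym (zeroˡ (f K)))) J ⟩
    W a (λ K → 0# * f K) J ≈⟨ W-* a 0# f J ⟩
    0# * W a f J         ≈⟨ zeroˡ _ ⟩
    0#                   ∎

  W-split : ∀ (a : Fin n → Carrier) k f g J →
            W a (λ K → k * f K + - g K) J ≈ k * W a f J + - W a g J
  W-split a k f g J = trans (W-+ a _ _ J) (+-cong (W-* a k f J) (W-neg a g J))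

  -- At a head in `J` each mixed product, `a zero` with `W b′ f₀` and `b zero` with `W a′ f₀`,
  -- occurs once with each sign; what survives is the same sum for the tails.
  W-anticomm : ∀ (a b : Fin n → Carrier) f J → W a (W b f) J + W b (W a f) J ≈ 0#
  W-anticomm a b f []          = +-identityˡ 0#
  W-anticomm a b f (false ∷ J) = W-anticomm _ _ _ J
  W-anticomm a b f (true ∷ J)  = begin
    (a zero * W b′ f₀ J + - W a′ (λ K → b zero * f₀ K + - W b′ f₁ K) J) +
    (b zero * W a′ f₀ J + - W b′ (λ K → a zero * f₀ K + - W a′ f₁ K) J)
      ≈⟨ +-cong (+-congˡ (-‿cong (W-split a′ _ _ _ J))) (+-congˡ (-‿cong (W-split b′ _ _ _ J))) ⟩
    (a zero * W b′ f₀ J + - (b zero * W a′ f₀ J + - W a′ (W b′ f₁) J)) +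
    (b zero * W a′ f₀ J + - (a zero * W b′ f₀ J + - W b′ (W a′ f₁) J))
      ≈⟨ solve 4 (λ x y u v → (x :+ :- (y :+ :- u)) :+ (y :+ :- (x :+ :- v)) := u :+ v) refl _ _ _ _ ⟩
    W a′ (W b′ f₁) J + W b′ (W a′ f₁) J
      ≈⟨ W-anticomm a′ b′ f₁ J ⟩
    0# ∎
    where
    a′ = a ∘ suc
    b′ = b ∘ suc
    f₀ = f ∘ (false ∷_)
    f₁ = f ∘ (true ∷_)

  -- Proved by its own induction: setting `b` to `a` in `W-anticomm` gives only that twice the value
  -- vanishes, and 2 need not be cancellable in the ring.
  W-square : ∀ (a : Fin n → Carrier) f J → W a (W a f) J ≈ 0#
  W-square a f []          = refl
  W-square a f (false ∷ J) = W-square _ _ J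
  W-square a f (true ∷ J)  = begin
    a zero * W a′ f₀ J + - W a′ (λ K → a zero * f₀ K + - W a′ f₁ K) J
      ≈⟨ +-congˡ (-‿cong (W-split a′ _ _ _ J)) ⟩
    a zero * W a′ f₀ J + - (a zero * W a′ f₀ J + - W a′ (W a′ f₁) J)
      ≈⟨ solve 2 (λ x u → x :+ :- (x :+ :- u) := u) refl _ _ ⟩
    W a′ (W a′ f₁) J
      ≈⟨ W-square a′ f₁ J ⟩
    0# ∎
    where
    a′ = a ∘ suc
    f₀ = f ∘ (false ∷_)
    f₁ = f ∘ (true ∷_)

  -- Pl is the sum over x of (e_x ∧) on the first factor tensored with the
  -- contraction by x on the second; Pl (p ⊗ p) is the Plücker sum of p up to sign.
  Pl : (Subset n → Subset n → Carrier) → Subset n → Subset n → Carrier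
  Pl F []          []          = 0#
  Pl F (false ∷ S) (false ∷ T) = Pl (λ S T → F (false ∷ S) (false ∷ T)) S T
  Pl F (false ∷ S) (true ∷ T)  = - Pl (λ S T → F (false ∷ S) (true ∷ T)) S T
  Pl F (true ∷ S)  (true ∷ T)  = Pl (λ S T → F (true ∷ S) (true ∷ T)) S T
  Pl F (true ∷ S)  (false ∷ T) =
    F (false ∷ S) (true ∷ T) + - Pl (λ S T → F (true ∷ S) (false ∷ T)) S T

  Wˡ Wʳ : (Fin n → Carrier) → (Subset n → Subset n → Carrier) → Subset n → Subset n → Carrier
  Wˡ a F S T = W a (λ S → F S T) S
  Wʳ a F S T = W a (F S) T

  Pl-cong : ∀ {F F′ : Subset n → Subset n → Carrier} → (∀ S T → F S T ≈ F′ S T) →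
            ∀ S T → Pl F S T ≈ Pl F′ S T
  Pl-cong eq []          []          = refl
  Pl-cong eq (false ∷ S) (false ∷ T) = Pl-cong (λ S T → eq _ _) S T
  Pl-cong eq (false ∷ S) (true ∷ T)  = -‿cong (Pl-cong (λ S T → eq _ _) S T)
  Pl-cong eq (true ∷ S)  (true ∷ T)  = Pl-cong (λ S T → eq _ _) S T
  Pl-cong eq (true ∷ S)  (false ∷ T) = +-cong (eq _ _) (-‿cong (Pl-cong (λ S T → eq _ _) S T))

  Pl-+ : ∀ (F F′ : Subset n → Subset n → Carrier) S T →
         Pl (λ S T → F S T + F′ S T) S T ≈ Pl F S T + Pl F′ S T
  Pl-+ F F′ []          []          = sym (+-identityˡ 0#)
  Pl-+ F F′ (false ∷ S) (false ∷ T) = Pl-+ _ _ S T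
  Pl-+ F F′ (true ∷ S)  (true ∷ T)  = Pl-+ _ _ S T
  Pl-+ F F′ (false ∷ S) (true ∷ T)  = trans (-‿cong (Pl-+ _ _ S T)) (sym (⁻¹-∙-comm _ _))
  Pl-+ F F′ (true ∷ S)  (false ∷ T) = trans (+-congˡ (-‿cong (Pl-+ _ _ S T)))
    (solve 4 (λ x y u v → (x :+ y) :+ :- (u :+ v) := (x :+ :- u) :+ (y :+ :- v)) refl _ _ _ _)

  Pl-* : ∀ k (F : Subset n → Subset n → Carrier) S T →
         Pl (λ S T → k * F S T) S T ≈ k * Pl F S T
  Pl-* k F []          []          = sym (zeroʳ k)
  Pl-* k F (false ∷ S) (false ∷ T) = Pl-* k _ S T
  Pl-* k F (true ∷ S)  (true ∷ T)  = Pl-* k _ S T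
  Pl-* k F (false ∷ S) (true ∷ T)  = trans (-‿cong (Pl-* k _ S T)) (-‿distribʳ-* _ _)
  Pl-* k F (true ∷ S)  (false ∷ T) = trans (+-congˡ (-‿cong (Pl-* k _ S T)))
    (solve 3 (λ k x u → k :* x :+ :- (k :* u) := k :* (x :+ :- u)) refl _ _ _)

  Pl-0 : ∀ {F : Subset n → Subset n → Carrier} → (∀ S T → F S T ≈ 0#) → ∀ S T → Pl F S T ≈ 0#
  Pl-0 {F = F} eq S T = begin
    Pl F S T                     ≈⟨ Pl-cong (λ S T → trans (eq S T) (sym (zeroˡ _))) S T ⟩
    Pl (λ S T → 0# * F S T) S T  ≈⟨ Pl-* 0# F S T ⟩
    0# * Pl F S T                ≈⟨ zeroˡ _ ⟩
    0#                           ∎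

  Pl-neg : ∀ (F : Subset n → Subset n → Carrier) S T →
           Pl (λ S T → - F S T) S T ≈ - Pl F S T
  Pl-neg F []          []          = sym ε⁻¹≈ε
  Pl-neg F (false ∷ S) (false ∷ T) = Pl-neg _ S T
  Pl-neg F (true ∷ S)  (true ∷ T)  = Pl-neg _ S T
  Pl-neg F (false ∷ S) (true ∷ T)  = -‿cong (Pl-neg _ S T)
  Pl-neg F (true ∷ S)  (false ∷ T) = trans (+-congˡ (-‿cong (Pl-neg _ S T))) (⁻¹-∙-comm _ _)

  Pl-split : ∀ k (F F′ : Subset n → Subset n → Carrier) S T →
             Pl (λ S T → k * F S T + - F′ S T) S T ≈ k * Pl F S T + - Pl F′ S T
  Pl-split k F F′ S T = trans (Pl-+ _ _ S T) (+-cong (Pl-* k F S T) (Pl-neg F′ S T))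

  -- Each `e_x ∧` anticommutes with `a ∧` on the left factor, and the contractions act on the other
  -- factor only.
  Pl-Wˡ : ∀ a (F : Subset n → Subset n → Carrier) S T →
          Pl (Wˡ a F) S T + Wˡ a (Pl F) S T ≈ 0#
  Pl-Wˡ a F []          []          = +-identityˡ 0#
  Pl-Wˡ a F (false ∷ S) (false ∷ T) = Pl-Wˡ _ _ S T
  Pl-Wˡ a F (false ∷ S) (true ∷ T)  = begin
    - Pl (Wˡ (a ∘ suc) F₀₁) S T + W (a ∘ suc) (λ S → - Pl F₀₁ S T) S
      ≈⟨ +-congˡ (W-neg _ _ S) ⟩
    - Pl (Wˡ (a ∘ suc) F₀₁) S T + - Wˡ (a ∘ suc) (Pl F₀₁) S T
      ≈⟨ ⁻¹-∙-comm _ _ ⟩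
    - (Pl (Wˡ (a ∘ suc) F₀₁) S T + Wˡ (a ∘ suc) (Pl F₀₁) S T)
      ≈⟨ -‿cong (Pl-Wˡ _ _ S T) ⟩
    - 0# ≈⟨ ε⁻¹≈ε ⟩
    0# ∎
    where F₀₁ = λ S T → F (false ∷ S) (true ∷ T)
  Pl-Wˡ a F (true ∷ S) (true ∷ T)  = begin
    Pl (λ S T → a zero * F₀₁ S T + - Wˡ a′ F₁₁ S T) S T +
    (a zero * - Pl F₀₁ S T + - Wˡ a′ (Pl F₁₁) S T)
      ≈⟨ +-congʳ (Pl-split _ _ _ S T) ⟩
    (a zero * Pl F₀₁ S T + - Pl (Wˡ a′ F₁₁) S T) +
    (a zero * - Pl F₀₁ S T + - Wˡ a′ (Pl F₁₁) S T)
      ≈⟨ solve 4 (λ a x u v → (a :* x :+ :- u) :+ (a :* (:- x) :+ :- v) := :- (u :+ v)) refl _ _ _ _ ⟩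
    - (Pl (Wˡ a′ F₁₁) S T + Wˡ a′ (Pl F₁₁) S T)
      ≈⟨ -‿cong (Pl-Wˡ _ _ S T) ⟩
    - 0# ≈⟨ ε⁻¹≈ε ⟩
    0# ∎
    where
    a′  = a ∘ suc
    F₀₁ = λ S T → F (false ∷ S) (true ∷ T)
    F₁₁ = λ S T → F (true ∷ S) (true ∷ T)
  Pl-Wˡ a F (true ∷ S) (false ∷ T)  = begin
    (Wˡ a′ F₀₁ S T + - Pl (λ S T → a zero * F₀₀ S T + - Wˡ a′ F₁₀ S T) S T) +
    (a zero * Pl F₀₀ S T + - W a′ (λ S → F₀₁ S T + - Pl F₁₀ S T) S)
      ≈⟨ +-cong (+-congˡ (-‿cong (Pl-split _ _ _ S T)))
                (+-congˡ (-‿cong (trans (W-+ a′ _ _ S) (+-congˡ (W-neg a′ _ S))))) ⟩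
    (Wˡ a′ F₀₁ S T + - (a zero * Pl F₀₀ S T + - Pl (Wˡ a′ F₁₀) S T)) +
    (a zero * Pl F₀₀ S T + - (Wˡ a′ F₀₁ S T + - Wˡ a′ (Pl F₁₀) S T))
      ≈⟨ solve 4 (λ x y u v → (x :+ :- (y :+ :- u)) :+ (y :+ :- (x :+ :- v)) := u :+ v) refl _ _ _ _ ⟩
    Pl (Wˡ a′ F₁₀) S T + Wˡ a′ (Pl F₁₀) S T
      ≈⟨ Pl-Wˡ _ _ S T ⟩
    0# ∎
    where
    a′  = a ∘ suc
    F₀₀ = λ S T → F (false ∷ S) (false ∷ T)
    F₀₁ = λ S T → F (false ∷ S) (true ∷ T)
    F₁₀ = λ S T → F (true ∷ S) (false ∷ T)

  -- Contraction is an antiderivation: contracting `a ∧ g` by `x` gives `a x` times `g` minus `a ∧`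
  -- the contraction of `g`. Summed over `x`, the first parts assemble the vectors `a x` times `e_x`
  -- into `a ∧` on the left factor.
  Pl-Wʳ : ∀ a (F : Subset n → Subset n → Carrier) S T →
          Pl (Wʳ a F) S T + Wʳ a (Pl F) S T ≈ Wˡ a F S T
  Pl-Wʳ a F []          []          = +-identityˡ 0#
  Pl-Wʳ a F (false ∷ S) (false ∷ T) = Pl-Wʳ _ _ S T
  Pl-Wʳ a F (false ∷ S) (true ∷ T)  = begin
    - Pl (λ S T → a zero * F₀₀ S T + - Wʳ a′ F₀₁ S T) S T +
    (a zero * Pl F₀₀ S T + - W a′ (λ T → - Pl F₀₁ S T) T)
      ≈⟨ +-cong (-‿cong (Pl-split _ _ _ S T)) (+-congˡ (-‿cong (W-neg a′ _ T))) ⟩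
    - (a zero * Pl F₀₀ S T + - Pl (Wʳ a′ F₀₁) S T) +
    (a zero * Pl F₀₀ S T + - - Wʳ a′ (Pl F₀₁) S T)
      ≈⟨ solve 3 (λ x u v → :- (x :+ :- u) :+ (x :+ :- (:- v)) := u :+ v) refl _ _ _ ⟩
    Pl (Wʳ a′ F₀₁) S T + Wʳ a′ (Pl F₀₁) S T
      ≈⟨ Pl-Wʳ _ _ S T ⟩
    Wˡ a′ F₀₁ S T ∎
    where
    a′  = a ∘ suc
    F₀₀ = λ S T → F (false ∷ S) (false ∷ T)
    F₀₁ = λ S T → F (false ∷ S) (true ∷ T)
  Pl-Wʳ a F (true ∷ S) (true ∷ T)  = begin
    Pl (λ S T → a zero * F₁₀ S T + - Wʳ a′ F₁₁ S T) S T +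
    (a zero * (F₀₁ S T + - Pl F₁₀ S T) + - Wʳ a′ (Pl F₁₁) S T)
      ≈⟨ +-congʳ (Pl-split _ _ _ S T) ⟩
    (a zero * Pl F₁₀ S T + - Pl (Wʳ a′ F₁₁) S T) +
    (a zero * (F₀₁ S T + - Pl F₁₀ S T) + - Wʳ a′ (Pl F₁₁) S T)
      ≈⟨ solve 5 (λ a x y u v → (a :* x :+ :- u) :+ (a :* (y :+ :- x) :+ :- v)
                              := a :* y :+ :- (u :+ v)) refl _ _ _ _ _ ⟩
    a zero * F₀₁ S T + - (Pl (Wʳ a′ F₁₁) S T + Wʳ a′ (Pl F₁₁) S T)
      ≈⟨ +-congˡ (-‿cong (Pl-Wʳ _ _ S T)) ⟩
    a zero * F₀₁ S T + - Wˡ a′ F₁₁ S T ∎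
    where
    a′  = a ∘ suc
    F₀₁ = λ S T → F (false ∷ S) (true ∷ T)
    F₁₀ = λ S T → F (true ∷ S) (false ∷ T)
    F₁₁ = λ S T → F (true ∷ S) (true ∷ T)
  Pl-Wʳ a F (true ∷ S) (false ∷ T)  = begin
    ((a zero * F₀₀ S T + - Wʳ a′ F₀₁ S T) + - Pl (Wʳ a′ F₁₀) S T) +
    W a′ (λ T → F₀₁ S T + - Pl F₁₀ S T) T
      ≈⟨ +-congˡ (trans (W-+ a′ _ _ T) (+-congˡ (W-neg a′ _ T))) ⟩
    ((a zero * F₀₀ S T + - Wʳ a′ F₀₁ S T) + - Pl (Wʳ a′ F₁₀) S T) +
    (Wʳ a′ F₀₁ S T + - Wʳ a′ (Pl F₁₀) S T)
      ≈⟨ solve 4 (λ x y u v → ((x :+ :- y) :+ :- u) :+ (y :+ :- v) := x :+ :- (u :+ v)) refl _ _ _ _ ⟩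
    a zero * F₀₀ S T + - (Pl (Wʳ a′ F₁₀) S T + Wʳ a′ (Pl F₁₀) S T)
      ≈⟨ +-congˡ (-‿cong (Pl-Wʳ _ _ S T)) ⟩
    a zero * F₀₀ S T + - Wˡ a′ F₁₀ S T ∎
    where
    a′  = a ∘ suc
    F₀₀ = λ S T → F (false ∷ S) (false ∷ T)
    F₀₁ = λ S T → F (false ∷ S) (true ∷ T)
    F₁₀ = λ S T → F (true ∷ S) (false ∷ T)

  _⊗_ : (Subset n → Carrier) → (Subset n → Carrier) → Subset n → Subset n → Carrier
  (f ⊗ g) S T = f S * g T

  -- The tensor square of `W a f` is `Wˡ a (Wʳ a (f ⊗ f))`. Moving `Pl` inward past both operators
  -- leaves a term with `Pl (f ⊗ f)`, zero by assumption, and a term with a double `W a` on the left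
  -- factor, zero by `W-square`.
  Pl-W-W : ∀ (a : Fin n → Carrier) f → (∀ S T → Pl (f ⊗ f) S T ≈ 0#) →
           ∀ S T → Pl (W a f ⊗ W a f) S T ≈ 0#
  Pl-W-W a f Pl≈0 S T = begin
    Pl (W a f ⊗ W a f) S T
      ≈⟨ Pl-cong (λ S T → begin
           W a f S * W a f T              ≈⟨ *-comm _ _ ⟩
           W a f T * W a f S              ≈⟨ W-* a _ f S ⟨
           W a (λ S → W a f T * f S) S    ≈⟨ W-cong a (λ S → *-comm _ _) S ⟩
           W a (λ S → f S * W a f T) S    ≈⟨ W-cong a (λ S → W-* a _ f T) S ⟨
           Wˡ a (Wʳ a (f ⊗ f)) S T        ∎) S T ⟩
    Pl (Wˡ a (Wʳ a (f ⊗ f))) S T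
      ≈⟨ inverseˡ-unique′ (Pl-Wˡ a _ S T) ⟩
    - Wˡ a (Pl (Wʳ a (f ⊗ f))) S T
      ≈⟨ -‿cong (W-cong a (λ S → begin
           Pl (Wʳ a (f ⊗ f)) S T                         ≈⟨ +-identityʳ _ ⟨
           Pl (Wʳ a (f ⊗ f)) S T + 0#                    ≈⟨ +-congˡ (W-0 a (Pl≈0 S) T) ⟨
           Pl (Wʳ a (f ⊗ f)) S T + Wʳ a (Pl (f ⊗ f)) S T ≈⟨ Pl-Wʳ a _ S T ⟩
           W a (λ S → f S * f T) S                       ≈⟨ W-cong a (λ S → *-comm _ _) S ⟩
           W a (λ S → f T * f S) S                       ≈⟨ W-* a _ f S ⟩
           f T * W a f S                                 ∎) S) ⟩
    - W a (λ S → f T * W a f S) S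
      ≈⟨ -‿cong (W-* a _ _ S) ⟩
    - (f T * W a (W a f) S)
      ≈⟨ -‿cong (trans (*-congˡ (W-square a f S)) (zeroʳ _)) ⟩
    - 0# ≈⟨ ε⁻¹≈ε ⟩
    0# ∎
    where
    inverseˡ-unique′ : ∀ {x y} → x + y ≈ 0# → x ≈ - y
    inverseˡ-unique′ {x} {y} eq = inverseʳ-unique y x (trans (+-comm y x) eq)

  -- The identity element of the exterior algebra, concentrated on the empty set.
  unit : Subset n → Carrier
  unit []          = 1#
  unit (true ∷ _)  = 0#
  unit (false ∷ J) = unit J

  wedge : ∀ {r} → (Fin r → Fin n → Carrier) → Subset n → Carrier
  wedge {r = zero}  A = unit
  wedge {r = suc r} A = W (A zero) (wedge (A ∘ suc))

  Pl-unit : ∀ (S T : Subset n) → Pl (unit ⊗ unit) S T ≈ 0#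
  Pl-unit []          []          = refl
  Pl-unit (false ∷ S) (false ∷ T) = Pl-unit S T
  Pl-unit (false ∷ S) (true ∷ T)  = trans (-‿cong (Pl-0 (λ S T → zeroʳ _) S T)) ε⁻¹≈ε
  Pl-unit (true ∷ S)  (true ∷ T)  = Pl-0 (λ S T → zeroˡ _) S T
  Pl-unit (true ∷ S)  (false ∷ T) = begin
    unit S * 0# + - Pl (λ S T → 0# * unit T) S T
      ≈⟨ +-cong (zeroʳ _) (-‿cong (Pl-0 (λ S T → zeroˡ _) S T)) ⟩
    0# + - 0#
      ≈⟨ -‿inverseʳ 0# ⟩
    0# ∎

  Pl-wedge : ∀ {r} (A : Fin r → Fin n → Carrier) S T → Pl (wedge A ⊗ wedge A) S T ≈ 0#
  Pl-wedge {r = zero}  A S T = Pl-unit S T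
  Pl-wedge {r = suc r} A S T = Pl-W-W _ _ (Pl-wedge (A ∘ suc)) S T

  -- The row occurs twice in the product: anticommuting it past the earlier rows brings the two
  -- copies together. Evaluated at a set of size `r` + 1 this is a linear relation among the maximal
  -- minors.
  row∧wedge : ∀ {r} (A : Fin r → Fin n → Carrier) i J → W (A i) (wedge A) J ≈ 0#
  row∧wedge {r = suc r} A zero    J = W-square _ _ J
  row∧wedge {r = suc r} A (suc i) J = begin
    W (A (suc i)) (W (A zero) (wedge (A ∘ suc))) J
      ≈⟨ +-identityʳ _ ⟨
    W (A (suc i)) (W (A zero) (wedge (A ∘ suc))) J + 0#
      ≈⟨ +-congˡ (W-0 (A zero) (row∧wedge (A ∘ suc) i) J) ⟨
    W (A (suc i)) (W (A zero) (wedge (A ∘ suc))) J + W (A zero) (W (A (suc i)) (wedge (A ∘ suc))) J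
      ≈⟨ W-anticomm _ _ _ J ⟩
    0# ∎

-- Subsets under insertion and deletion.

module Subsets where
  private variable n : ℕ

  ∉⇒lookup : ∀ {x} {J : Subset n} → x ∉ J → lookup J x ≡ false
  ∉⇒lookup {x = x} {J} x∉J with lookup J x in eq
  ... | true  = contradiction (lookup⇒[]= x J eq) x∉J
  ... | false = ≡.refl

  lookup⇒∉ : ∀ {x} {J : Subset n} → lookup J x ≡ false → x ∉ J
  lookup⇒∉ eq x∈J with () ← ≡.trans (≡.sym eq) ([]=⇒lookup x∈J)

  lookup-separates : ∀ (J : Subset n) {x y} → lookup J x ≡ true → lookup J y ≡ false → x ≢ y
  lookup-separates J x∈ y∉ ≡.refl with () ← ≡.trans (≡.sym x∈) y∉

  lookup-insert : ∀ {x y} (J : Subset n) → lookup (J [ x ]≔ true) y ≡ true → y ≢ x → lookup J y ≡ true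
  lookup-insert J y∈ y≢x = ≡.trans (≡.sym (lookup∘update′ y≢x J true)) y∈

  lookup-delete : ∀ {x y} (J : Subset n) → lookup (J [ x ]≔ false) y ≡ true → lookup J y ≡ true
  lookup-delete {x = zero}  {suc y} (_ ∷ J) y∈ = y∈
  lookup-delete {x = suc x} {zero}  (_ ∷ J) y∈ = y∈
  lookup-delete {x = suc x} {suc y} (_ ∷ J) y∈ = lookup-delete J y∈

  insert-lookup : ∀ {x y} (J : Subset n) → lookup J y ≡ true → lookup (J [ x ]≔ true) y ≡ true
  insert-lookup {x = zero}  {zero}  (_ ∷ J) y∈ = ≡.refl
  insert-lookup {x = zero}  {suc y} (_ ∷ J) y∈ = y∈
  insert-lookup {x = suc x} {zero}  (_ ∷ J) y∈ = y∈
  insert-lookup {x = suc x} {suc y} (_ ∷ J) y∈ = insert-lookup J y∈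

  ∣insert∣ : ∀ {x} (J : Subset n) → lookup J x ≡ false → ∣ J [ x ]≔ true ∣ ≡ suc ∣ J ∣
  ∣insert∣ {x = zero}  (false ∷ J) x∉J = ≡.refl
  ∣insert∣ {x = suc x} (true ∷ J)  x∉J = ≡.cong suc (∣insert∣ J x∉J)
  ∣insert∣ {x = suc x} (false ∷ J) x∉J = ∣insert∣ J x∉J

  ∣delete∣ : ∀ {x} (J : Subset n) → lookup J x ≡ true → suc ∣ J [ x ]≔ false ∣ ≡ ∣ J ∣
  ∣delete∣ {x = zero}  (true ∷ J)  x∈J = ≡.refl
  ∣delete∣ {x = suc x} (true ∷ J)  x∈J = ≡.cong suc (∣delete∣ J x∈J)
  ∣delete∣ {x = suc x} (false ∷ J) x∈J = ∣delete∣ J x∈J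

  ∣insert─∣ : ∀ {x} (J K : Subset n) → lookup J x ≡ false → lookup K x ≡ false →
              ∣ (J [ x ]≔ true) ─ K ∣ ≡ suc ∣ J ─ K ∣
  ∣insert─∣ {x = zero}  (false ∷ J) (false ∷ K) x∉J x∉K = ≡.refl
  ∣insert─∣ {x = suc x} (_ ∷ J)     (true ∷ K)  x∉J x∉K = ∣insert─∣ J K x∉J x∉K
  ∣insert─∣ {x = suc x} (true ∷ J)  (false ∷ K) x∉J x∉K = ≡.cong suc (∣insert─∣ J K x∉J x∉K)
  ∣insert─∣ {x = suc x} (false ∷ J) (false ∷ K) x∉J x∉K = ∣insert─∣ J K x∉J x∉K

  ∣update─∣ : ∀ {x s} (J K : Subset n) → lookup K x ≡ true → ∣ (J [ x ]≔ s) ─ K ∣ ≡ ∣ J ─ K ∣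
  ∣update─∣ {x = zero}  (_ ∷ J)     (true ∷ K)  x∈K = ≡.refl
  ∣update─∣ {x = suc x} (_ ∷ J)     (true ∷ K)  x∈K = ∣update─∣ J K x∈K
  ∣update─∣ {x = suc x} (true ∷ J)  (false ∷ K) x∈K = ≡.cong suc (∣update─∣ J K x∈K)
  ∣update─∣ {x = suc x} (false ∷ J) (false ∷ K) x∈K = ∣update─∣ J K x∈K

  ∣delete─∣ : ∀ {x} (J K : Subset n) → lookup J x ≡ true → lookup K x ≡ false →
              suc ∣ (J [ x ]≔ false) ─ K ∣ ≡ ∣ J ─ K ∣
  ∣delete─∣ {x = zero}  (true ∷ J)  (false ∷ K) x∈J x∉K = ≡.refl
  ∣delete─∣ {x = suc x} (_ ∷ J)     (true ∷ K)  x∈J x∉K = ∣delete─∣ J K x∈J x∉K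
  ∣delete─∣ {x = suc x} (true ∷ J)  (false ∷ K) x∈J x∉K = ≡.cong suc (∣delete─∣ J K x∈J x∉K)
  ∣delete─∣ {x = suc x} (false ∷ J) (false ∷ K) x∈J x∉K = ∣delete─∣ J K x∈J x∉K

  ∣delete─∣≤ : ∀ x (J K : Subset n) → ∣ (J [ x ]≔ false) ─ K ∣ ℕ.≤ ∣ J ─ K ∣
  ∣delete─∣≤ zero    (_ ∷ J)     (true ∷ K)  = ℕₚ.≤-refl
  ∣delete─∣≤ zero    (true ∷ J)  (false ∷ K) = ℕₚ.n≤1+n _
  ∣delete─∣≤ zero    (false ∷ J) (false ∷ K) = ℕₚ.≤-refl
  ∣delete─∣≤ (suc x) (_ ∷ J)     (true ∷ K)  = ∣delete─∣≤ x J K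
  ∣delete─∣≤ (suc x) (true ∷ J)  (false ∷ K) = ℕ.s≤s (∣delete─∣≤ x J K)
  ∣delete─∣≤ (suc x) (false ∷ J) (false ∷ K) = ∣delete─∣≤ x J K

  ∣J─J∣≡0 : ∀ (J : Subset n) → ∣ J ─ J ∣ ≡ 0
  ∣J─J∣≡0 []          = ≡.refl
  ∣J─J∣≡0 (true ∷ J)  = ∣J─J∣≡0 J
  ∣J─J∣≡0 (false ∷ J) = ∣J─J∣≡0 J

  ∣─∣≡suc⇒witness : ∀ (J K : Subset n) {d} → ∣ J ─ K ∣ ≡ suc d →
                    Σ (Fin n) λ x → lookup J x ≡ true × lookup K x ≡ false
  ∣─∣≡suc⇒witness []          []          ()
  ∣─∣≡suc⇒witness (true ∷ J)  (false ∷ K) eq = zero , ≡.refl , ≡.refl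
  ∣─∣≡suc⇒witness (false ∷ J) (false ∷ K) eq with x , p ← ∣─∣≡suc⇒witness J K eq = suc x , p
  ∣─∣≡suc⇒witness (_ ∷ J)     (true ∷ K)  eq with x , p ← ∣─∣≡suc⇒witness J K eq = suc x , p

  ∣─∣≡0⇒⊆ : ∀ (J K : Subset n) → ∣ J ─ K ∣ ≡ 0 → ∀ x → lookup J x ≡ true → lookup K x ≡ true
  ∣─∣≡0⇒⊆ (_ ∷ J)     (true ∷ K)  eq zero    x∈J = ≡.refl
  ∣─∣≡0⇒⊆ (_ ∷ J)     (true ∷ K)  eq (suc x) x∈J = ∣─∣≡0⇒⊆ J K eq x x∈J
  ∣─∣≡0⇒⊆ (false ∷ J) (false ∷ K) eq (suc x) x∈J = ∣─∣≡0⇒⊆ J K eq x x∈J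

  ⊆∧∣∣≡⇒≡ : ∀ (J K : Subset n) → (∀ x → lookup J x ≡ true → lookup K x ≡ true) →
            ∣ J ∣ ≡ ∣ K ∣ → J ≡ K
  ⊆∧∣∣≡⇒≡ []          []          sub eq = ≡.refl
  ⊆∧∣∣≡⇒≡ (true ∷ J)  (true ∷ K)  sub eq = ≡.cong (true ∷_) (⊆∧∣∣≡⇒≡ J K (sub ∘ suc) (ℕₚ.suc-injective eq))
  ⊆∧∣∣≡⇒≡ (true ∷ J)  (false ∷ K) sub eq with () ← sub zero ≡.refl
  ⊆∧∣∣≡⇒≡ (false ∷ J) (false ∷ K) sub eq = ≡.cong (false ∷_) (⊆∧∣∣≡⇒≡ J K (sub ∘ suc) eq)
  ⊆∧∣∣≡⇒≡ (false ∷ J) (true ∷ K)  sub eq = contradiction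
    (p⊆q⇒∣p∣≤∣q∣ {p = J} {q = K} (λ {x} x∈J → lookup⇒[]= x K (sub (suc x) ([]=⇒lookup x∈J))))
    (ℕₚ.<⇒≱ (ℕₚ.≤-reflexive (≡.sym eq)))

  update-same : ∀ {x s} (J : Subset n) → lookup J x ≡ s → J [ x ]≔ s ≡ J
  update-same {x = zero}  (_ ∷ J) eq = ≡.cong (_∷ J) (≡.sym eq)
  update-same {x = suc x} (s ∷ J) eq = ≡.cong (s ∷_) (update-same J eq)

  update-update : ∀ x {s t} (J : Subset n) → (J [ x ]≔ s) [ x ]≔ t ≡ J [ x ]≔ t
  update-update zero    (_ ∷ J) = ≡.refl
  update-update (suc x) (s ∷ J) = ≡.cong (s ∷_) (update-update x J)

  update-comm : ∀ {x y s t} (J : Subset n) → x ≢ y → (J [ x ]≔ s) [ y ]≔ t ≡ (J [ y ]≔ t) [ x ]≔ s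
  update-comm {x = zero}  {zero}  (_ ∷ J) x≢y = contradiction ≡.refl x≢y
  update-comm {x = zero}  {suc y} (_ ∷ J) x≢y = ≡.refl
  update-comm {x = suc x} {zero}  (_ ∷ J) x≢y = ≡.refl
  update-comm {x = suc x} {suc y} (s ∷ J) x≢y = ≡.cong (s ∷_) (update-comm J (x≢y ∘ ≡.cong suc))

  -- Together with `∪≡insert` this translates the set operations of the definitions into vector
  -- updates, for which lookups, sizes and commutations are easy to compute.
  -≡delete : ∀ (J : Subset n) x → J - x ≡ J [ x ]≔ false
  -≡delete (s ∷ J) zero    = ≡.cong (false ∷_) (p─⊥≡p J)
  -≡delete (s ∷ J) (suc x) = ≡.cong (s ∷_) (-≡delete J x)

  ∪≡insert : ∀ (J : Subset n) x → J ∪ ⁅ x ⁆ ≡ J [ x ]≔ true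
  ∪≡insert (true ∷ J)  zero    = ≡.cong (true ∷_) (∪-identityʳ J)
  ∪≡insert (false ∷ J) zero    = ≡.cong (true ∷_) (∪-identityʳ J)
  ∪≡insert (true ∷ J)  (suc x) = ≡.cong (true ∷_) (∪≡insert J x)
  ∪≡insert (false ∷ J) (suc x) = ≡.cong (false ∷_) (∪≡insert J x)
open Subsets

-- Coordinate expansions and comparison of signs.

module Expansion {c ℓ g} (P : PartialField c ℓ g) where
  open CommutativeRing (PartialField.R P) hiding (zero; _-_)
  open PartialField P using (G; InP; G-resp; G-one; G-minusOne; G-mul; G-inv)
  open PF P using (sumFin; signPow; above; sign; X; pluckerSum)
  open FiniteSums P
  open Exterior P
  open SetoidReasoning setoid
  open IntegerSolver (PartialField.R P)
  open RingProperties ring using (-‿distribˡ-*; -1*x≈-x)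
  open AbelianGroupProperties +-abelianGroup using (ε⁻¹≈ε; ⁻¹-involutive)

  private variable n : ℕ

  G-neg : ∀ {x} → G x → G (- x)
  G-neg Gx = G-resp (-1*x≈-x _) (G-mul G-minusOne Gx)

  -- The ring may have zero divisors, so the arguments below cancel only factors known to lie in
  -- `G`.
  G-cancelˡ : ∀ {k x y} → G k → k * x ≈ k * y → x ≈ y
  G-cancelˡ {k} {x} {y} Gk eq with k⁻¹ , _ , inverse ← G-inv Gk = begin
    x              ≈⟨ *-identityˡ x ⟨
    1# * x         ≈⟨ *-congʳ (trans (*-comm _ _) inverse) ⟨
    k⁻¹ * k * x    ≈⟨ *-assoc _ _ _ ⟩
    k⁻¹ * (k * x)  ≈⟨ *-congˡ eq ⟩
    k⁻¹ * (k * y)  ≈⟨ *-assoc _ _ _ ⟨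
    k⁻¹ * k * y    ≈⟨ *-congʳ (trans (*-comm _ _) inverse) ⟩
    1# * y         ≈⟨ *-identityˡ y ⟩
    y              ∎

  InP-mul : ∀ {x y} → InP x → InP y → InP (x * y)
  InP-mul (inj₁ Gx)  (inj₁ Gy)  = inj₁ (G-mul Gx Gy)
  InP-mul (inj₁ _)   (inj₂ y≈0) = inj₂ (trans (*-congˡ y≈0) (zeroʳ _))
  InP-mul (inj₂ x≈0) _          = inj₂ (trans (*-congʳ x≈0) (zeroˡ _))

  InP-neg : ∀ {x} → InP x → InP (- x)
  InP-neg (inj₁ Gx)  = inj₁ (G-neg Gx)
  InP-neg (inj₂ x≈0) = inj₂ (trans (-‿cong x≈0) ε⁻¹≈ε)

  -- ε S x is the sign of x in S, and η T x the sign of inserting x into T: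
  -- minus one to the number of smaller elements, or 0 where not applicable.
  ε η : Subset n → Fin n → Carrier
  ε (true ∷ S)  zero    = 1#
  ε (false ∷ S) zero    = 0#
  ε (true ∷ S)  (suc x) = - ε S x
  ε (false ∷ S) (suc x) = ε S x
  η (true ∷ T)  zero    = 0#
  η (false ∷ T) zero    = 1#
  η (true ∷ T)  (suc x) = - η T x
  η (false ∷ T) (suc x) = η T x

  ε-∉ : ∀ (S : Subset n) x → lookup S x ≡ false → ε S x ≈ 0#
  ε-∉ (false ∷ S) zero    eq = refl
  ε-∉ (true ∷ S)  (suc x) eq = trans (-‿cong (ε-∉ S x eq)) ε⁻¹≈ε
  ε-∉ (false ∷ S) (suc x) eq = ε-∉ S x eq

  ε-∈ : ∀ (S : Subset n) x → lookup S x ≡ true → G (ε S x)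
  ε-∈ (true ∷ S)  zero    eq = G-one
  ε-∈ (true ∷ S)  (suc x) eq = G-neg (ε-∈ S x eq)
  ε-∈ (false ∷ S) (suc x) eq = ε-∈ S x eq

  ε-square : ∀ (S : Subset n) x → lookup S x ≡ true → ε S x * ε S x ≈ 1#
  ε-square (true ∷ S)  zero    eq = *-identityˡ 1#
  ε-square (true ∷ S)  (suc x) eq =
    trans (solve 1 (λ e → (:- e) :* (:- e) := e :* e) refl _) (ε-square S x eq)
  ε-square (false ∷ S) (suc x) eq = ε-square S x eq

  η-∈ : ∀ (T : Subset n) x → lookup T x ≡ true → η T x ≈ 0#
  η-∈ (true ∷ T)  zero    eq = refl
  η-∈ (true ∷ T)  (suc x) eq = trans (-‿cong (η-∈ T x eq)) ε⁻¹≈ε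
  η-∈ (false ∷ T) (suc x) eq = η-∈ T x eq

  η-∉ : ∀ (T : Subset n) x → lookup T x ≡ false → G (η T x)
  η-∉ (false ∷ T) zero    eq = G-one
  η-∉ (true ∷ T)  (suc x) eq = G-neg (η-∉ T x eq)
  η-∉ (false ∷ T) (suc x) eq = η-∉ T x eq

  -- Laplace expansion along `a`. The sum runs over all of `Fin n`, since `ε` is zero outside `S`.
  W-expand : ∀ (a : Fin n → Carrier) f S →
             W a f S ≈ sumFin (λ x → ε S x * (a x * f (S [ x ]≔ false)))
  W-expand a f []          = refl
  W-expand a f (false ∷ S) =
    trans (W-expand _ _ S) (sym (trans (+-congʳ (zeroˡ _)) (+-identityˡ _)))
  W-expand {suc n} a f (true ∷ S) = +-cong (sym (*-identityˡ _)) (begin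
    - W (a ∘ suc) (f ∘ (true ∷_)) S ≈⟨ -‿cong (W-expand _ _ S) ⟩
    - sumFin term                   ≈⟨ sum-neg term ⟨
    sumFin (λ x → - term x)         ≈⟨ sum-cong {n} (λ x → -‿distribˡ-* _ _) ⟩
    sumFin (λ x → - ε S x * (a (suc x) * f (true ∷ (S [ x ]≔ false)))) ∎)
    where term = λ x → ε S x * (a (suc x) * f (true ∷ (S [ x ]≔ false)))

  Pl-term : (Subset n → Subset n → Carrier) → (S T : Subset n) → Fin n → Carrier
  Pl-term F S T x = (ε S x * η T x) * F (S [ x ]≔ false) (T [ x ]≔ true)

  -- By induction on the head bits: a head in both sets changes two signs at once, a head in exactly
  -- one set changes one. The factor `ε S x * η T x` restricts the sum to the `x` in `S` and outside
  -- `T`.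
  Pl-expand : ∀ (F : Subset n → Subset n → Carrier) S T → Pl F S T ≈ sumFin (Pl-term F S T)
  Pl-expand F []          []          = refl
  Pl-expand F (false ∷ S) (false ∷ T) = begin
    Pl F′ S T                     ≈⟨ Pl-expand F′ S T ⟩
    sumFin (Pl-term F′ S T)       ≈⟨ +-identityˡ _ ⟨
    0# + sumFin (Pl-term F′ S T)  ≈⟨ +-congʳ (trans (*-congʳ (zeroˡ 1#)) (zeroˡ _)) ⟨
    sumFin (Pl-term F (false ∷ S) (false ∷ T)) ∎
    where F′ = λ S T → F (false ∷ S) (false ∷ T)
  Pl-expand {suc n} F (true ∷ S) (true ∷ T) = begin
    Pl F′ S T                     ≈⟨ Pl-expand F′ S T ⟩
    sumFin (Pl-term F′ S T)       ≈⟨ +-identityˡ _ ⟨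
    0# + sumFin (Pl-term F′ S T)
      ≈⟨ +-cong (trans (*-congʳ (zeroʳ 1#)) (zeroˡ _)) (sum-cong {n} (λ x →
           solve 3 (λ e h y → ((:- e) :* (:- h)) :* y := (e :* h) :* y) refl (ε S x) (η T x) _)) ⟨
    sumFin (Pl-term F (true ∷ S) (true ∷ T)) ∎
    where F′ = λ S T → F (true ∷ S) (true ∷ T)
  Pl-expand {suc n} F (false ∷ S) (true ∷ T) = begin
    - Pl F′ S T                            ≈⟨ -‿cong (Pl-expand F′ S T) ⟩
    - sumFin (Pl-term F′ S T)              ≈⟨ sum-neg (Pl-term F′ S T) ⟨
    sumFin (λ x → - Pl-term F′ S T x)      ≈⟨ +-identityˡ _ ⟨
    0# + sumFin (λ x → - Pl-term F′ S T x)
      ≈⟨ +-cong (trans (*-congʳ (zeroˡ 0#)) (zeroˡ _)) (sum-cong {n} (λ x →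
           solve 3 (λ e h y → (e :* (:- h)) :* y := :- ((e :* h) :* y)) refl (ε S x) (η T x) _)) ⟨
    sumFin (Pl-term F (false ∷ S) (true ∷ T)) ∎
    where F′ = λ S T → F (false ∷ S) (true ∷ T)
  Pl-expand {suc n} F (true ∷ S) (false ∷ T) = +-cong
    (sym (trans (*-congʳ (*-identityˡ 1#)) (*-identityˡ _))) (begin
    - Pl F′ S T                            ≈⟨ -‿cong (Pl-expand F′ S T) ⟩
    - sumFin (Pl-term F′ S T)              ≈⟨ sum-neg (Pl-term F′ S T) ⟨
    sumFin (λ x → - Pl-term F′ S T x)
      ≈⟨ sum-cong {n} (λ x →
           solve 3 (λ e h y → ((:- e) :* h) :* y := :- ((e :* h) :* y)) refl (ε S x) (η T x) _) ⟨
    sumFin (λ x → (- ε S x * η T x) * F′ (S [ x ]≔ false) (T [ x ]≔ true)) ∎)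
    where F′ = λ S T → F (true ∷ S) (false ∷ T)

  Pl-term-cong : ∀ (F F′ : Subset n → Subset n → Carrier) (S T : Subset n) x →
    (lookup S x ≡ true → lookup T x ≡ false →
     F (S [ x ]≔ false) (T [ x ]≔ true) ≈ F′ (S [ x ]≔ false) (T [ x ]≔ true)) →
    Pl-term F S T x ≈ Pl-term F′ S T x
  Pl-term-cong F F′ S T x eq with lookup S x in eqS | lookup T x in eqT
  ... | true  | false = *-congˡ (eq ≡.refl ≡.refl)
  ... | false | _     = trans (vanish _) (sym (vanish _))
    where
    vanish : ∀ y → (ε S x * η T x) * y ≈ 0#
    vanish y = trans (*-congʳ (trans (*-congʳ (ε-∉ S x eqS)) (zeroˡ _))) (zeroˡ y)
  ... | true  | true  = trans (vanish _) (sym (vanish _))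
    where
    vanish : ∀ y → (ε S x * η T x) * y ≈ 0#
    vanish y = trans (*-congʳ (trans (*-congˡ (η-∈ T x eqT)) (zeroʳ _))) (zeroˡ y)

  -- Agreement is demanded only at the pairs that `Pl` evaluates. This matters because the
  -- coordinates of `p` are controlled only at sets of size `r`.
  Pl-cong-on : ∀ (F F′ : Subset n → Subset n → Carrier) S T →
    (∀ x → lookup S x ≡ true → lookup T x ≡ false →
     F (S [ x ]≔ false) (T [ x ]≔ true) ≈ F′ (S [ x ]≔ false) (T [ x ]≔ true)) →
    Pl F S T ≈ Pl F′ S T
  Pl-cong-on {n} F F′ S T eq = trans (Pl-expand F S T)
    (trans (sum-cong {n} (λ x → Pl-term-cong F F′ S T x (eq x))) (sym (Pl-expand F′ S T)))

  -- The sign of the summand at `y` is in `G` and cancels once all other summands agree. Every later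
  -- use of a Plücker equation to find one unknown product goes through this lemma, with `F′` zero
  -- when the product is to vanish.
  Pl-isolate : ∀ (F F′ : Subset n → Subset n → Carrier) S T y →
    Pl F S T ≈ Pl F′ S T → lookup S y ≡ true → lookup T y ≡ false →
    (∀ x → x ≢ y → lookup S x ≡ true → lookup T x ≡ false →
     F (S [ x ]≔ false) (T [ x ]≔ true) ≈ F′ (S [ x ]≔ false) (T [ x ]≔ true)) →
    F (S [ y ]≔ false) (T [ y ]≔ true) ≈ F′ (S [ y ]≔ false) (T [ y ]≔ true)
  Pl-isolate F F′ S T y eq y∈S y∉T others =
    G-cancelˡ (G-mul (ε-∈ S y y∈S) (η-∉ T y y∉T))
      (sum-isolate y (trans (sym (Pl-expand F S T)) (trans eq (Pl-expand F′ S T)))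
        (λ x x≢y → Pl-term-cong F F′ S T x (others x x≢y)))

  signPow-+ : ∀ i j → signPow (i ℕ.+ j) ≈ signPow i * signPow j
  signPow-+ zero    j = sym (*-identityˡ _)
  signPow-+ (suc i) j = trans (-‿cong (signPow-+ i j)) (-‿distribˡ-* _ _)

  signPow-square : ∀ i → signPow i * signPow i ≈ 1#
  signPow-square zero    = *-identityˡ 1#
  signPow-square (suc i) =
    trans (solve 1 (λ e → (:- e) :* (:- e) := e :* e) refl _) (signPow-square i)

  ∩-all : ∀ (S : Subset n) → ∣ S ∩ tabulate (λ _ → true) ∣ ≡ ∣ S ∣
  ∩-all []          = ≡.refl
  ∩-all (true ∷ S)  = ≡.cong suc (∩-all S)
  ∩-all (false ∷ S) = ∩-all S

  -- The definition of `sign` counts larger elements and `ε` counts smaller ones. Together with `x`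
  -- itself they make up `S`, whence the factor `signPow ∣ S ∣` and the extra minus sign.
  signPow-above-∈ : ∀ (S : Subset n) x → lookup S x ≡ true →
                    signPow ∣ S ∩ above x ∣ ≈ - (signPow ∣ S ∣ * ε S x)
  signPow-above-∈ (true ∷ S) zero eq = begin
    signPow ∣ S ∩ tabulate (λ _ → true) ∣ ≡⟨ ≡.cong signPow (∩-all S) ⟩
    signPow ∣ S ∣                         ≈⟨ ⁻¹-involutive _ ⟨
    - - signPow ∣ S ∣                     ≈⟨ -‿cong (*-identityʳ _) ⟨
    - (- signPow ∣ S ∣ * 1#)              ∎
  signPow-above-∈ (true ∷ S) (suc x) eq = begin
    signPow ∣ S ∩ above x ∣        ≈⟨ signPow-above-∈ S x eq ⟩
    - (signPow ∣ S ∣ * ε S x)      ≈⟨ solve 2 (λ a b → :- (a :* b) := :- ((:- a) :* (:- b))) refl _ _ ⟩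
    - (- signPow ∣ S ∣ * - ε S x)  ∎
  signPow-above-∈ (false ∷ S) (suc x) eq = signPow-above-∈ S x eq

  signPow-above-∉ : ∀ (T : Subset n) x → lookup T x ≡ false →
                    signPow ∣ T ∩ above x ∣ ≈ signPow ∣ T ∣ * η T x
  signPow-above-∉ (false ∷ T) zero eq = begin
    signPow ∣ T ∩ tabulate (λ _ → true) ∣ ≡⟨ ≡.cong signPow (∩-all T) ⟩
    signPow ∣ T ∣                         ≈⟨ *-identityʳ _ ⟨
    signPow ∣ T ∣ * 1#                    ∎
  signPow-above-∉ (true ∷ T) (suc x) eq = begin
    signPow ∣ T ∩ above x ∣    ≈⟨ signPow-above-∉ T x eq ⟩
    signPow ∣ T ∣ * η T x      ≈⟨ solve 2 (λ a b → a :* b := (:- a) :* (:- b)) refl _ _ ⟩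
    - signPow ∣ T ∣ * - η T x  ∎
  signPow-above-∉ (false ∷ T) (suc x) eq = signPow-above-∉ T x eq

  -- Since the sizes of `S` and `T` have the same parity, their two sign factors multiply to 1. The
  -- minus sign that remains does not depend on `x`, so it comes out of the whole sum.
  sign≈ : ∀ (S T : Subset n) x → ∣ S ∣ ≡ suc (suc ∣ T ∣) → lookup S x ≡ true → lookup T x ≡ false →
          sign x S T ≈ - (ε S x * η T x)
  sign≈ S T x size x∈S x∉T = begin
    signPow (∣ S ∩ above x ∣ ℕ.+ ∣ T ∩ above x ∣)
      ≈⟨ signPow-+ ∣ S ∩ above x ∣ _ ⟩
    signPow ∣ S ∩ above x ∣ * signPow ∣ T ∩ above x ∣
      ≈⟨ *-cong (signPow-above-∈ S x x∈S) (signPow-above-∉ T x x∉T) ⟩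
    - (signPow ∣ S ∣ * ε S x) * (signPow ∣ T ∣ * η T x)
      ≡⟨ ≡.cong (λ k → - (signPow k * ε S x) * (signPow ∣ T ∣ * η T x)) size ⟩
    - (- - signPow ∣ T ∣ * ε S x) * (signPow ∣ T ∣ * η T x)
      ≈⟨ solve 3 (λ s e h → :- ((:- (:- s)) :* e) :* (s :* h) := (s :* s) :* (:- (e :* h))) refl _ _ _ ⟩
    (signPow ∣ T ∣ * signPow ∣ T ∣) * - (ε S x * η T x)
      ≈⟨ *-congʳ (signPow-square ∣ T ∣) ⟩
    1# * - (ε S x * η T x)
      ≈⟨ *-identityˡ _ ⟩
    - (ε S x * η T x) ∎

  X-size : ∀ r (p : Subset n → Carrier) J → ∣ J ∣ ≡ r → X r p J ≈ p J
  X-size r p J size with ∣ J ∣ ℕ.≟ r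
  ... | yes _ = refl
  ... | no ¬size = contradiction size ¬size

  X-¬size : ∀ r (p : Subset n → Carrier) J → ∣ J ∣ ≢ r → X r p J ≈ 0#
  X-¬size r p J ¬size with ∣ J ∣ ℕ.≟ r
  ... | yes size = contradiction size ¬size
  ... | no _ = refl

  -- Extracts the summands of pluckerSum, which are local to its definition.
  pluckerTerm : ∀ r (p : Subset n → Carrier) S T →
                Σ (Fin n → Carrier) λ t → sumFin t ≡ pluckerSum r p S T
  pluckerTerm r p S T = _ , ≡.refl

  pluckerTerm≈ : ∀ r (p : Subset n → Carrier) S T → ∣ S ∣ ≡ suc r → suc ∣ T ∣ ≡ r →
                 ∀ x → proj₁ (pluckerTerm r p S T) x ≈ - Pl-term (p ⊗ p) S T x
  pluckerTerm≈ r p S T sizeS sizeT x with x ∈? S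
  ... | no x∉S = sym (begin
    - Pl-term (p ⊗ p) S T x
      ≈⟨ -‿cong (*-congʳ (trans (*-congʳ (ε-∉ S x (∉⇒lookup x∉S))) (zeroˡ _))) ⟩
    - (0# * _) ≈⟨ -‿cong (zeroˡ _) ⟩
    - 0#       ≈⟨ ε⁻¹≈ε ⟩
    0#         ∎)
  ... | yes x∈S with lookup T x in eq
  -- Here `T ∪ ⁅ x ⁆` is `T`, one element too small, so `X` takes its default value 0; on the other
  -- side `η` is 0.
  ...   | true  = begin
    sign x S T * (X r p (S - x) * X r p (T ∪ ⁅ x ⁆))
      ≈⟨ *-congˡ (*-congˡ (X-¬size r p (T ∪ ⁅ x ⁆) λ size → ℕₚ.1+n≢n {∣ T ∣} (≡.trans sizeT (≡.trans (≡.sym size)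
           (≡.cong ∣_∣ (≡.trans (∪≡insert T x) (update-same T eq))))))) ⟩
    sign x S T * (X r p (S - x) * 0#)
      ≈⟨ *-congˡ (zeroʳ _) ⟩
    sign x S T * 0#
      ≈⟨ zeroʳ _ ⟩
    0# ≈⟨ ε⁻¹≈ε ⟨
    - 0# ≈⟨ -‿cong (zeroˡ _) ⟨
    - (0# * _) ≈⟨ -‿cong (*-congʳ (trans (*-congˡ (η-∈ T x eq)) (zeroʳ _))) ⟨
    - Pl-term (p ⊗ p) S T x ∎
  ...   | false = begin
    sign x S T * (X r p (S - x) * X r p (T ∪ ⁅ x ⁆))
      ≡⟨ ≡.cong₂ (λ J K → sign x S T * (X r p J * X r p K)) (-≡delete S x) (∪≡insert T x) ⟩
    sign x S T * (X r p (S [ x ]≔ false) * X r p (T [ x ]≔ true))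
      ≈⟨ *-cong (sign≈ S T x (≡.trans sizeS (≡.cong suc (≡.sym sizeT))) x∈S′ eq) (*-cong
           (X-size r p _ (ℕₚ.suc-injective (≡.trans (∣delete∣ S x∈S′) sizeS)))
           (X-size r p _ (≡.trans (∣insert∣ T eq) sizeT))) ⟩
    - (ε S x * η T x) * (p (S [ x ]≔ false) * p (T [ x ]≔ true))
      ≈⟨ -‿distribˡ-* _ _ ⟨
    - Pl-term (p ⊗ p) S T x ∎
    where x∈S′ = []=⇒lookup x∈S

  pluckerSum≈Pl : ∀ r (p : Subset n → Carrier) S T → ∣ S ∣ ≡ suc r → suc ∣ T ∣ ≡ r →
                  pluckerSum r p S T ≈ - Pl (p ⊗ p) S T
  pluckerSum≈Pl {n} r p S T sizeS sizeT = begin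
    pluckerSum r p S T                      ≡⟨ proj₂ (pluckerTerm r p S T) ⟨
    sumFin (proj₁ (pluckerTerm r p S T))    ≈⟨ sum-cong {n} (pluckerTerm≈ r p S T sizeS sizeT) ⟩
    sumFin (λ x → - Pl-term (p ⊗ p) S T x)  ≈⟨ sum-neg (Pl-term (p ⊗ p) S T) ⟩
    - sumFin (Pl-term (p ⊗ p) S T)          ≈⟨ -‿cong (Pl-expand _ S T) ⟨
    - Pl (p ⊗ p) S T                        ∎

-- Maximal minors as coordinates of the wedge of the rows.

module Determinants {c ℓ g} (P : PartialField c ℓ g) where
  open CommutativeRing (PartialField.R P) hiding (zero; _-_)
  open PartialField P using (G; G-resp; G-one; G-mul)
  open PF P using (sumFin; signPow; det; elems; subMatrix)
  open FiniteSums P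
  open Exterior P
  open SetoidReasoning setoid
  open RingProperties ring using (-‿distribˡ-*)

  private variable n r : ℕ

  elems-∈ : ∀ (J : Subset n) k → lookup J (elems J k) ≡ true
  elems-∈ (true ∷ J)  zero    = ≡.refl
  elems-∈ (true ∷ J)  (suc k) = elems-∈ J k
  elems-∈ (false ∷ J) k       = elems-∈ J k

  elems-surjective : ∀ (J : Subset n) x → lookup J x ≡ true → Σ (Fin ∣ J ∣) λ k → elems J k ≡ x
  elems-surjective (true ∷ J)  zero    x∈J = zero , ≡.refl
  elems-surjective (true ∷ J)  (suc x) x∈J with k , eq ← elems-surjective J x x∈J = suc k , ≡.cong suc eq
  elems-surjective (false ∷ J) (suc x) x∈J with k , eq ← elems-surjective J x x∈J = k , ≡.cong suc eq

  elems-injective : ∀ (J : Subset n) {k l} → elems J k ≡ elems J l → k ≡ l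
  elems-injective (true ∷ J)  {zero}  {zero}  eq = ≡.refl
  elems-injective (true ∷ J)  {suc k} {suc l} eq = ≡.cong suc (elems-injective J (suc-injective eq))
  elems-injective (false ∷ J) eq = elems-injective J (suc-injective eq)

  -- Reconciles deletion by position, as in `det`, with deletion by element, as in `W`. The size
  -- equations are carried by `cast`, which reduces on constructors and so lets the induction on `J`
  -- go through.
  elems-punchIn : ∀ (J : Subset n) {m} (eq : suc m ≡ ∣ J ∣) (j : Fin (suc m)) (l : Fin m)
                  (eq′ : m ≡ ∣ J [ elems J (cast eq j) ]≔ false ∣) →
                  elems J (cast eq (punchIn j l)) ≡ elems (J [ elems J (cast eq j) ]≔ false) (cast eq′ l)
  elems-punchIn (true ∷ J)  eq zero    l       eq′ = ≡.refl
  elems-punchIn (true ∷ J)  eq (suc j) zero    eq′ = ≡.refl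
  elems-punchIn (true ∷ J)  {suc m} eq (suc j) (suc l) eq′ =
    ≡.cong suc (elems-punchIn J (ℕₚ.suc-injective eq) j l (ℕₚ.suc-injective eq′))
  elems-punchIn (false ∷ J) eq j l eq′ = ≡.cong suc (elems-punchIn J eq j l eq′)

  det-cong : ∀ {k} {M N : Fin k → Fin k → Carrier} → (∀ i j → M i j ≈ N i j) → det M ≈ det N
  det-cong {zero}  eq = refl
  det-cong {suc k} eq = sum-cong {suc k} (λ j → *-congˡ {x = signPow (toℕ j)}
    (*-cong (eq zero j) (det-cong (λ i l → eq (suc i) (punchIn j l)))))

  -- Only column `zero` survives in each first-row expansion, so the determinant is the product of
  -- the diagonal entries.
  det-diagonal : ∀ {k} (M : Fin k → Fin k → Carrier) → (∀ i → G (M i i)) →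
                 (∀ i j → i ≢ j → M i j ≈ 0#) → G (det M)
  det-diagonal {zero}  M diagonal off = G-one
  det-diagonal {suc k} M diagonal off = G-resp (sym (begin
      det M
        ≈⟨ sum-single {suc k} {term} zero (λ j j≢0 → trans (*-congˡ (trans
             (*-congʳ (off zero j (j≢0 ∘ ≡.sym))) (zeroˡ _))) (zeroʳ _)) ⟩
      1# * (M zero zero * det M′)
        ≈⟨ *-identityˡ _ ⟩
      M zero zero * det M′ ∎))
    (G-mul (diagonal zero) (det-diagonal M′ (diagonal ∘ suc) (λ i j i≢j → off _ _ (i≢j ∘ suc-injective))))
    where
    M′ = λ i j → M (suc i) (suc j)
    term = λ j → signPow (toℕ j) * (M zero j * det (λ i l → M (suc i) (punchIn j l)))

  sum-cast : ∀ {k m} (eq : k ≡ m) (f : Fin m → Carrier) → sumFin (f ∘ cast eq) ≈ sumFin f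
  sum-cast {k} ≡.refl f = sum-cong {k} (λ i → reflexive (≡.cong f (cast-is-id ≡.refl i)))

  -- The expansion of `W-expand` reindexed by positions in `J`, the indexing that `det` uses.
  W-elems : ∀ (a : Fin n → Carrier) f J → W a f J ≈
            sumFin (λ k → signPow (toℕ k) * (a (elems J k) * f (J [ elems J k ]≔ false)))
  W-elems a f []          = refl
  W-elems a f (false ∷ J) = W-elems (a ∘ suc) (f ∘ (false ∷_)) J
  W-elems a f (true ∷ J)  = +-cong (sym (*-identityˡ _)) (begin
    - W (a ∘ suc) (f ∘ (true ∷_)) J  ≈⟨ -‿cong (W-elems _ _ J) ⟩
    - sumFin term                    ≈⟨ sum-neg term ⟨
    sumFin (λ k → - term k)          ≈⟨ sum-cong {∣ J ∣} (λ k → -‿distribˡ-* _ _) ⟩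
    sumFin (λ k → - signPow (toℕ k) * (a (suc (elems J k)) * f (true ∷ (J [ elems J k ]≔ false)))) ∎)
    where term = λ k → signPow (toℕ k) * (a (suc (elems J k)) * f (true ∷ (J [ elems J k ]≔ false)))

  unit-∅ : ∀ (J : Subset n) → ∣ J ∣ ≡ 0 → unit J ≈ 1#
  unit-∅ []          eq = refl
  unit-∅ (false ∷ J) eq = unit-∅ J eq

  -- Induction on the number of rows: both sides expand along the first row, and `elems-punchIn`
  -- identifies the remaining columns.
  det≈wedge : ∀ (A : Fin r → Fin n → Carrier) J (eq : ∣ J ∣ ≡ r) → det (subMatrix A J eq) ≈ wedge A J
  det≈wedge {zero}      A J eq = sym (unit-∅ J eq)
  det≈wedge {suc r} {n} A J eq = begin
    det (subMatrix A J eq)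
      ≈⟨ sum-cong {suc r} (λ j → *-cong
           (reflexive (≡.cong signPow (≡.sym (toℕ-cast (≡.sym eq) j))))
           (*-cong (reflexive (≡.cong (A zero ∘ elems J) (subst-is-cast (≡.sym eq) j)))
                   (trans (det-cong (λ i l → reflexive (≡.cong (A (suc i)) (column j l))))
                          (det≈wedge (A ∘ suc) (J′ j) (size j))))) ⟩
    sumFin (term ∘ cast (≡.sym eq))
      ≈⟨ sum-cast (≡.sym eq) term ⟩
    sumFin term
      ≈⟨ W-elems _ _ J ⟨
    wedge A J ∎
    where
    term = λ k → signPow (toℕ k) * (A zero (elems J k) * wedge (A ∘ suc) (J [ elems J k ]≔ false))
    J′ = λ j → J [ elems J (cast (≡.sym eq) j) ]≔ false
    size : ∀ j → ∣ J′ j ∣ ≡ r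
    size j = ℕₚ.suc-injective (≡.trans (∣delete∣ J (elems-∈ J _)) eq)
    column : ∀ j l → elems J (≡.subst Fin (≡.sym eq) (punchIn j l)) ≡
                     elems (J′ j) (≡.subst Fin (≡.sym (size j)) l)
    column j l = ≡.trans (≡.cong (elems J) (subst-is-cast (≡.sym eq) _))
      (≡.trans (elems-punchIn J (≡.sym eq) j l (≡.sym (size j)))
               (≡.cong (elems (J′ j)) (≡.sym (subst-is-cast (≡.sym (size j)) l))))

-- A constructive case split. `B` need not be the negation of `A`: in the applications `A` includes
-- a coordinate being in `G` and `B` concludes that it is zero, which `InP` decides.
search : ∀ {a b n} {A : Fin n → Set a} {B : Fin n → Set b} →
         (∀ x → A x ⊎ B x) → Σ (Fin n) A ⊎ (∀ x → B x)
search {n = zero}  dec = inj₂ λ ()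
search {n = suc n} dec with dec zero | search (dec ∘ suc)
... | inj₁ Ax | _             = inj₁ (zero , Ax)
... | inj₂ _  | inj₁ (x , Ax) = inj₁ (suc x , Ax)
... | inj₂ B0 | inj₂ Bs       = inj₂ λ { zero → B0 ; (suc x) → Bs x }

-- Agreement of two coordinate vectors by induction on the distance from a basis.

module Agreement {c ℓ g} (P : PartialField c ℓ g) where
  open CommutativeRing (PartialField.R P) hiding (zero; _-_)
  open PartialField P using (G; InP)
  open Exterior P
  open Expansion P
  open SetoidReasoning setoid

  private variable n : ℕ

  -- The hypotheses are asymmetric: `p` comes with exchange toward the fixed `B` and the 3-term
  -- equations, `q` with all Plücker equations. Exchange is phrased with `G` so that the coordinate
  -- it reaches can be cancelled.
  module _ (r : ℕ) (p q : Subset n → Carrier) (B : Subset n) (size-B : ∣ B ∣ ≡ r)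
    (G≉0 : ∀ {x} → G x → ¬ (x ≈ 0#))
    (p-InP : ∀ J → ∣ J ∣ ≡ r → InP (p J))
    (exchange : ∀ J → ∣ J ∣ ≡ r → G (p J) → ∀ x → lookup J x ≡ true → lookup B x ≡ false →
      Σ (Fin n) λ y → lookup B y ≡ true × lookup J y ≡ false × G (p ((J [ x ]≔ false) [ y ]≔ true)))
    (p-Plücker : ∀ S T → ∣ S ∣ ≡ suc r → suc ∣ T ∣ ≡ r → ∣ S ─ T ∣ ≡ 3 → Pl (p ⊗ p) S T ≈ 0#)
    (q-Plücker : ∀ S T → Pl (q ⊗ q) S T ≈ 0#)
    (pB : G (p B)) (agree-B : p B ≈ q B)
    (agree-neighbour : ∀ b x → lookup B b ≡ true → lookup B x ≡ false →
      p ((B [ b ]≔ false) [ x ]≔ true) ≈ q ((B [ b ]≔ false) [ x ]≔ true))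
    where

    -- Removing from `J` its only element `c` outside `B` leaves a subset of `B` with one element
    -- `b` missing, so `J` is `B` with `b` replaced by `c`.
    neighbour : ∀ J → ∣ J ∣ ≡ r → ∣ J ─ B ∣ ≡ 1 → p J ≈ q J
    neighbour J size dist with c , c∈J , c∉B ← ∣─∣≡suc⇒witness J B dist
      = ≡.subst (λ K → p K ≈ q K) (≡.sym J≡) (agree-neighbour b c b∈B c∉B)
      where
      T = J [ c ]≔ false
      size-T : suc ∣ T ∣ ≡ ∣ B ∣
      size-T = ≡.trans (∣delete∣ J c∈J) (≡.trans size (≡.sym size-B))
      T⊆B : ∀ x → lookup T x ≡ true → lookup B x ≡ true
      T⊆B = ∣─∣≡0⇒⊆ T B (ℕₚ.suc-injective (≡.trans (∣delete─∣ J B c∈J c∉B) dist))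
      B⊈T : Σ (Fin n) λ x → lookup B x ≡ true × lookup T x ≡ false
      B⊈T with ∣ B ─ T ∣ in eq
      ... | suc _ = ∣─∣≡suc⇒witness B T eq
      ... | zero  = contradiction
        (p⊆q⇒∣p∣≤∣q∣ {p = B} {q = T} (λ {x} x∈B → lookup⇒[]= x T (∣─∣≡0⇒⊆ B T eq x ([]=⇒lookup x∈B))))
        (ℕₚ.<⇒≱ (ℕₚ.≤-reflexive size-T))
      b = proj₁ B⊈T
      b∈B = proj₁ (proj₂ B⊈T)
      b∉T = proj₂ (proj₂ B⊈T)
      T≡ : T ≡ B [ b ]≔ false
      T≡ = ⊆∧∣∣≡⇒≡ T (B [ b ]≔ false)
        (λ x x∈T → ≡.trans (lookup∘update′ (lookup-separates T x∈T b∉T) B false) (T⊆B x x∈T))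
        (ℕₚ.suc-injective (≡.trans size-T (≡.sym (∣delete∣ B b∈B))))
      J≡ : J ≡ (B [ b ]≔ false) [ c ]≔ true
      J≡ = ≡.trans (≡.sym (≡.trans (update-update c J) (update-same J c∈J))) (≡.cong (_[ c ]≔ true) T≡)

    module Step (J : Subset n) (size : ∣ J ∣ ≡ r) (e : ℕ) (dist : ∣ J ─ B ∣ ≡ suc (suc e))
      (closer : ∀ K → ∣ K ∣ ≡ r → ∣ K ─ B ∣ ≤ suc e → p K ≈ q K)
      (c : Fin n) (c∈J : lookup J c ≡ true) (c∉B : lookup B c ≡ false) where

      T : Subset n
      T = J [ c ]≔ false

      c∉T : lookup T c ≡ false
      c∉T = lookup∘update c J false

      T+c : T [ c ]≔ true ≡ J
      T+c = ≡.trans (update-update c J) (update-same J c∈J)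

      size-T : suc ∣ T ∣ ≡ r
      size-T = ≡.trans (∣delete∣ J c∈J) size

      dist-T : ∣ T ─ B ∣ ≡ suc e
      dist-T = ℕₚ.suc-injective (≡.trans (∣delete─∣ J B c∈J c∉B) dist)

      -- Putting an element of `B` in the place of `c` lowers the distance by one, so the induction
      -- hypothesis applies.
      closer-T : ∀ x → lookup B x ≡ true → lookup T x ≡ false → p (T [ x ]≔ true) ≈ q (T [ x ]≔ true)
      closer-T x x∈B x∉T = closer _ (≡.trans (∣insert∣ T x∉T) size-T)
        (ℕₚ.≤-reflexive (≡.trans (∣update─∣ T B x∈B) dist-T))

      -- If `p J` were in `G`, exchanging `c` would contradict `none`. For `q`, the Plücker equation
      -- below loses every summand but `q B * q J`, because each other one contains some
      -- `q (T [ x ]≔ true)`, which equals the vanishing coordinate of `p`.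
      no-exchange : (∀ x → lookup B x ≡ true → lookup J x ≡ false → p (T [ x ]≔ true) ≈ 0#) → p J ≈ q J
      no-exchange none = trans p≈0 (sym q≈0)
        where
        p≈0 : p J ≈ 0#
        p≈0 with p-InP J size
        ... | inj₂ eq = eq
        ... | inj₁ GpJ with y , y∈B , y∉J , Gy ← exchange J size GpJ c c∈J c∉B
          = contradiction (none y y∈B y∉J) (G≉0 Gy)
        -- `S ─ T` has `e` + 3 elements here, so the full Plücker equations of `q` are called on.
        S = B [ c ]≔ true
        product : q (S [ c ]≔ false) * q (T [ c ]≔ true) ≈ 0#
        product = Pl-isolate (q ⊗ q) (λ _ _ → 0#) S T c
          (trans (q-Plücker S T) (sym (Pl-0 (λ _ _ → refl) S T)))
          (lookup∘update c B true) c∉T λ x x≢c x∈S x∉T →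
            let x∈B = lookup-insert B x∈S x≢c
                x∉J = ≡.trans (≡.sym (lookup∘update′ x≢c J false)) x∉T
            in trans (*-congˡ (trans (sym (closer-T x x∈B x∉T)) (none x x∈B x∉J))) (zeroʳ _)
        q≈0 : q J ≈ 0#
        q≈0 = G-cancelˡ pB (begin
          p B * q J  ≈⟨ *-congʳ agree-B ⟩
          q B * q J  ≡⟨ ≡.cong₂ (λ K L → q K * q L) (≡.trans (update-update c B) (update-same B c∉B)) T+c ⟨
          q (S [ c ]≔ false) * q (T [ c ]≔ true) ≈⟨ product ⟩
          0#         ≈⟨ zeroʳ _ ⟨
          p B * 0#   ∎)

      -- From `J₁` one more exchange reaches a basis `J₂` at distance `e`. With `S` equal to `J₂`
      -- plus `c`, the summand at `c` is `p J₂ * p J`, and the other two involve only sets at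
      -- distance at most `e` + 1, where `p` and `q` agree. Since `p J₂` is in `G`, it cancels.
      three-term : ∀ b → lookup B b ≡ true → lookup J b ≡ false → G (p (T [ b ]≔ true)) → p J ≈ q J
      three-term b b∈B b∉J GpJ₁ = G-cancelˡ GpJ₂ (begin
        p J₂ * p J ≡⟨ ≡.cong₂ (λ K L → p K * p L) S-c T+c ⟨
        p (S [ c ]≔ false) * p (T [ c ]≔ true) ≈⟨ product ⟩
        q (S [ c ]≔ false) * q (T [ c ]≔ true) ≡⟨ ≡.cong₂ (λ K L → q K * q L) S-c T+c ⟩
        q J₂ * q J ≈⟨ *-congʳ (closer J₂ size-J₂ (ℕₚ.≤-trans (ℕₚ.≤-reflexive dist-J₂) (ℕₚ.n≤1+n e))) ⟨
        p J₂ * q J ∎)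
        where
        c≢b : c ≢ b
        c≢b = lookup-separates J c∈J b∉J
        b∉T : lookup T b ≡ false
        b∉T = ≡.trans (lookup∘update′ (c≢b ∘ ≡.sym) J false) b∉J
        J₁ = T [ b ]≔ true
        size-J₁ : ∣ J₁ ∣ ≡ r
        size-J₁ = ≡.trans (∣insert∣ T b∉T) size-T
        dist-J₁ : ∣ J₁ ─ B ∣ ≡ suc e
        dist-J₁ = ≡.trans (∣update─∣ T B b∈B) dist-T
        -- `J₁` is still not `B`, because `J` was at distance at least two. As `c₂` lies outside
        -- `B`, it differs from `b` and hence belongs to `T`.
        c₂-witness = ∣─∣≡suc⇒witness J₁ B dist-J₁
        c₂ = proj₁ c₂-witness
        c₂∈J₁ = proj₁ (proj₂ c₂-witness)
        c₂∉B = proj₂ (proj₂ c₂-witness)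
        c₂∈T : lookup T c₂ ≡ true
        c₂∈T = lookup-insert T c₂∈J₁ (lookup-separates B b∈B c₂∉B ∘ ≡.sym)
        b₂-witness = exchange J₁ size-J₁ GpJ₁ c₂ c₂∈J₁ c₂∉B
        b₂ = proj₁ b₂-witness
        b₂∈B = proj₁ (proj₂ b₂-witness)
        b₂∉J₁ = proj₁ (proj₂ (proj₂ b₂-witness))
        V = J₁ [ c₂ ]≔ false
        J₂ = V [ b₂ ]≔ true
        GpJ₂ : G (p J₂)
        GpJ₂ = proj₂ (proj₂ (proj₂ b₂-witness))
        S = J₂ [ c ]≔ true
        b₂∉V : lookup V b₂ ≡ false
        b₂∉V = ≡.trans (lookup∘update′ (lookup-separates J₁ c₂∈J₁ b₂∉J₁ ∘ ≡.sym) J₁ false) b₂∉J₁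
        b₂∉T : lookup T b₂ ≡ false
        b₂∉T with lookup T b₂ in eq
        ... | false = ≡.refl
        ... | true  = ≡.trans (≡.sym (insert-lookup T eq)) b₂∉J₁
        c∉J₂ : lookup J₂ c ≡ false
        c∉J₂ = ≡.trans (lookup∘update′ (lookup-separates B b₂∈B c∉B ∘ ≡.sym) V true)
          (≡.trans (lookup∘update′ (lookup-separates T c₂∈T c∉T ∘ ≡.sym) J₁ false)
          (≡.trans (lookup∘update′ c≢b T true) c∉T))
        size-J₂ : ∣ J₂ ∣ ≡ r
        size-J₂ = ≡.trans (∣insert∣ V b₂∉V) (≡.trans (∣delete∣ J₁ c₂∈J₁) size-J₁)
        dist-J₂ : ∣ J₂ ─ B ∣ ≡ e
        dist-J₂ = ≡.trans (∣update─∣ V B b₂∈B)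
          (ℕₚ.suc-injective (≡.trans (∣delete─∣ J₁ B c₂∈J₁ c₂∉B) dist-J₁))
        size-S : ∣ S ∣ ≡ suc r
        size-S = ≡.trans (∣insert∣ J₂ c∉J₂) (≡.cong suc size-J₂)
        dist-S : ∣ S ─ B ∣ ≡ suc e
        dist-S = ≡.trans (∣insert─∣ J₂ B c∉J₂ c∉B) (≡.cong suc dist-J₂)
        -- The three elements are `c`, `b₂` and `b`; the deletion of `c₂` does not affect the count,
        -- as `c₂` is in `T`.
        ∣S─T∣ : ∣ S ─ T ∣ ≡ 3
        ∣S─T∣ = ≡.trans (∣insert─∣ J₂ T c∉J₂ c∉T) (≡.cong suc
          (≡.trans (∣insert─∣ V T b₂∉V b₂∉T) (≡.cong suc
          (≡.trans (∣update─∣ J₁ T c₂∈T)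
          (≡.trans (∣insert─∣ T T b∉T b∉T) (≡.cong suc (∣J─J∣≡0 T)))))))
        S-c : S [ c ]≔ false ≡ J₂
        S-c = ≡.trans (update-update c J₂) (update-same J₂ c∉J₂)
        S─T⊆B : ∀ x → x ≢ c → lookup S x ≡ true → lookup T x ≡ false → lookup B x ≡ true
        S─T⊆B x x≢c x∈S x∉T with x ≟ b | x ≟ b₂
        ... | yes ≡.refl | _          = b∈B
        ... | no _       | yes ≡.refl = b₂∈B
        ... | no x≢b     | no x≢b₂    = contradiction ≡.refl
          (lookup-separates T (lookup-insert T (lookup-delete J₁ (lookup-insert V
            (lookup-insert J₂ x∈S x≢c) x≢b₂)) x≢b) x∉T)
        product : (p ⊗ p) (S [ c ]≔ false) (T [ c ]≔ true) ≈ (q ⊗ q) (S [ c ]≔ false) (T [ c ]≔ true)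
        product = Pl-isolate (p ⊗ p) (q ⊗ q) S T c
          (trans (p-Plücker S T size-S size-T ∣S─T∣) (sym (q-Plücker S T)))
          (lookup∘update c J₂ true) c∉T λ x x≢c x∈S x∉T → *-cong
            (closer _ (ℕₚ.suc-injective (≡.trans (∣delete∣ S x∈S) size-S))
              (ℕₚ.≤-trans (∣delete─∣≤ x S B) (ℕₚ.≤-reflexive dist-S)))
            (closer-T x (S─T⊆B x x≢c x∈S x∉T) x∉T)

      step : p J ≈ q J
      step with search decide
        where
        decide : ∀ x → (lookup B x ≡ true × lookup J x ≡ false × G (p (T [ x ]≔ true))) ⊎
                       (lookup B x ≡ true → lookup J x ≡ false → p (T [ x ]≔ true) ≈ 0#)
        decide x with lookup B x | lookup J x in eqJ
        ... | false | _     = inj₂ λ ()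
        ... | true  | true  = inj₂ λ _ ()
        ... | true  | false with p-InP (T [ x ]≔ true) (≡.trans (∣insert∣ T
                (≡.trans (lookup∘update′ (lookup-separates J c∈J eqJ ∘ ≡.sym) J false) eqJ)) size-T)
        ...   | inj₁ Gx  = inj₁ (≡.refl , ≡.refl , Gx)
        ...   | inj₂ x≈0 = inj₂ λ _ _ → x≈0
      ... | inj₁ (b , b∈B , b∉J , Gb) = three-term b b∈B b∉J Gb
      ... | inj₂ none                 = no-exchange none

    -- The bound `d` makes the recursion structural while `Step` receives the hypothesis for all
    -- closer sets at once. Distances 0 and 1 are base cases, since `Step` needs two elements to
    -- exchange.
    agree-within : ∀ d J → ∣ J ∣ ≡ r → ∣ J ─ B ∣ ≤ d → p J ≈ q J
    agree-within d J size d≥ with ∣ J ─ B ∣ in eq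
    agree-within d J size d≥ | zero = ≡.subst (λ K → p K ≈ q K)
      (≡.sym (⊆∧∣∣≡⇒≡ J B (∣─∣≡0⇒⊆ J B eq) (≡.trans size (≡.sym size-B)))) agree-B
    agree-within d J size d≥ | suc zero = neighbour J size eq
    agree-within (suc d) J size (ℕ.s≤s d≥) | suc (suc e)
      with c , c∈J , c∉B ← ∣─∣≡suc⇒witness J B eq
      = Step.step J size e eq (λ K size-K near → agree-within d K size-K (ℕₚ.≤-trans near d≥)) c c∈J c∉B

    agree : ∀ J → ∣ J ∣ ≡ r → p J ≈ q J
    agree J size = agree-within ∣ J ─ B ∣ J size ℕₚ.≤-refl

-- The implications between the three conditions.

module Equivalences {c ℓ g} (P : PartialField c ℓ g) {n r : ℕ}
  (p : Subset n → PartialField.Carrier P) (point : PF.IsPoint P r p) where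
  open CommutativeRing (PartialField.R P) hiding (zero; _-_)
  open PartialField P using (G; InP; G-resp; G-mul; G-inv)
  open PF P using (pluckerSum; Plucker; StrongPMatroid; Representable; det; elems; subMatrix)
  open PF₂ P using (support; WeakPMatroid)
  open FiniteSums P
  open Exterior P
  open Expansion P
  open Determinants P
  open SetoidReasoning setoid
  open IntegerSolver (PartialField.R P)
  open AbelianGroupProperties +-abelianGroup using (ε⁻¹≈ε; ⁻¹-involutive; inverseʳ-unique)

  -- A unit equal to 0 would make 1 equal to 0 and every coordinate zero, but a point has a nonzero
  -- coordinate.
  G≉0 : ∀ {x} → G x → ¬ (x ≈ 0#)
  G≉0 {x} Gx x≈0 with J , _ , pJ≉0 ← proj₂ point | y , _ , xy≈1 ← G-inv Gx
    = pJ≉0 (begin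
      p J            ≈⟨ *-identityˡ _ ⟨
      1# * p J       ≈⟨ *-congʳ xy≈1 ⟨
      (x * y) * p J  ≈⟨ *-congʳ (trans (*-congʳ x≈0) (zeroˡ y)) ⟩
      0# * p J       ≈⟨ zeroˡ _ ⟩
      0#             ∎)

  ≉0⇒G : ∀ {x} → InP x → ¬ (x ≈ 0#) → G x
  ≉0⇒G (inj₁ Gx)  _   = Gx
  ≉0⇒G (inj₂ x≈0) x≉0 = contradiction x≈0 x≉0

  pluckerSum≈0⇒Pl≈0 : ∀ S T → ∣ S ∣ ≡ suc r → suc ∣ T ∣ ≡ r → pluckerSum r p S T ≈ 0# → Pl (p ⊗ p) S T ≈ 0#
  pluckerSum≈0⇒Pl≈0 S T size-S size-T eq = begin
    Pl (p ⊗ p) S T         ≈⟨ ⁻¹-involutive _ ⟨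
    - - Pl (p ⊗ p) S T     ≈⟨ -‿cong (pluckerSum≈Pl r p S T size-S size-T) ⟨
    - pluckerSum r p S T   ≈⟨ -‿cong eq ⟩
    - 0#                   ≈⟨ ε⁻¹≈ε ⟩
    0#                     ∎

  -- The relations are quadratic, so rescaling `p` by `a` multiplies them by `a * a`, which is in
  -- `G`. The rescaled `p` matches the wedge at sets of size `r`, and `Pl-cong-on` asks for no more.
  representable⇒strong : Representable r p → StrongPMatroid r p
  representable⇒strong (A , _ , a , Ga , a*p≈det) = point , λ S T size-S size-T → begin
    pluckerSum r p S T  ≈⟨ pluckerSum≈Pl r p S T size-S size-T ⟩
    - Pl (p ⊗ p) S T    ≈⟨ -‿cong (G-cancelˡ (G-mul Ga Ga) (begin
      (a * a) * Pl (p ⊗ p) S T                   ≈⟨ Pl-* (a * a) (p ⊗ p) S T ⟨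
      Pl (λ S T → (a * a) * (p ⊗ p) S T) S T
        ≈⟨ Pl-cong-on (λ S T → (a * a) * (p ⊗ p) S T) (wedge A ⊗ wedge A) S T (λ x x∈S x∉T → begin
             (a * a) * (p (S [ x ]≔ false) * p (T [ x ]≔ true))
               ≈⟨ solve 3 (λ a x y → (a :* a) :* (x :* y) := (a :* x) :* (a :* y)) refl a _ _ ⟩
             (a * p (S [ x ]≔ false)) * (a * p (T [ x ]≔ true))
               ≈⟨ *-cong (coordinate _ (ℕₚ.suc-injective (≡.trans (∣delete∣ S x∈S) size-S)))
                         (coordinate _ (≡.trans (∣insert∣ T x∉T) size-T)) ⟩
             wedge A (S [ x ]≔ false) * wedge A (T [ x ]≔ true) ∎) ⟩
      Pl (wedge A ⊗ wedge A) S T                 ≈⟨ Pl-wedge A S T ⟩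
      0#                                         ≈⟨ zeroʳ _ ⟨
      (a * a) * 0#                               ∎)) ⟩
    - 0#                ≈⟨ ε⁻¹≈ε ⟩
    0#                  ∎
    where
    coordinate : ∀ J → ∣ J ∣ ≡ r → a * p J ≈ wedge A J
    coordinate J size = trans (a*p≈det J size) (det≈wedge A J size)

  -- In the equation for `B₂` plus `x` and `B₁` minus `x`, the summand at `x` is, up to sign, the
  -- unit `p B₂ * p B₁`; every other one contains a coordinate of a candidate exchange. If all
  -- candidates vanished, a unit would be 0.
  strong⇒exchange : Plucker r p → ∀ B₁ B₂ → support r p B₁ → support r p B₂ →
    ∀ x → x ∈ B₁ → x ∉ B₂ → Σ (Fin n) λ y → y ∈ B₂ × y ∉ B₁ × support r p ((B₁ - x) ∪ ⁅ y ⁆)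
  strong⇒exchange plücker B₁ B₂ (size₁ , p₁≉0) (size₂ , p₂≉0) x x∈B₁ x∉B₂ with search decide
    where
    decide : ∀ y → (y ∈ B₂ × y ∉ B₁ × support r p ((B₁ - x) ∪ ⁅ y ⁆)) ⊎
                   (lookup B₂ y ≡ true → lookup B₁ y ≡ false → p ((B₁ [ x ]≔ false) [ y ]≔ true) ≈ 0#)
    decide y with lookup B₂ y in eq₂ | lookup B₁ y in eq₁
    ... | false | _     = inj₂ λ ()
    ... | true  | true  = inj₂ λ _ ()
    ... | true  | false
      with size ← ≡.trans (∣insert∣ (B₁ [ x ]≔ false) (≡.trans
             (lookup∘update′ (lookup-separates B₁ ([]=⇒lookup x∈B₁) eq₁ ∘ ≡.sym) B₁ false) eq₁))
             (≡.trans (∣delete∣ B₁ ([]=⇒lookup x∈B₁)) size₁)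
      with proj₁ point ((B₁ [ x ]≔ false) [ y ]≔ true) size
    ... | inj₂ ≈0 = inj₂ λ _ _ → ≈0
    ... | inj₁ Gy = inj₁ (lookup⇒[]= y B₂ eq₂ , lookup⇒∉ eq₁ ,
      ≡.subst (support r p) (≡.sym (≡.trans (∪≡insert (B₁ - x) y)
        (≡.cong (_[ y ]≔ true) (-≡delete B₁ x)))) (size , G≉0 Gy))
  ... | inj₁ found = found
  ... | inj₂ none  = contradiction product
    (G≉0 (G-mul (≉0⇒G (proj₁ point B₂ size₂) p₂≉0) (≉0⇒G (proj₁ point B₁ size₁) p₁≉0)))
    where
    x∈ = []=⇒lookup x∈B₁
    x∉ = ∉⇒lookup x∉B₂
    S = B₂ [ x ]≔ true
    T = B₁ [ x ]≔ false
    size-S : ∣ S ∣ ≡ suc r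
    size-S = ≡.trans (∣insert∣ B₂ x∉) (≡.cong suc size₂)
    size-T : suc ∣ T ∣ ≡ r
    size-T = ≡.trans (∣delete∣ B₁ x∈) size₁
    product : p B₂ * p B₁ ≈ 0#
    product = begin
      p B₂ * p B₁
        ≡⟨ ≡.cong₂ (λ K L → p K * p L) (≡.trans (update-update x B₂) (update-same B₂ x∉))
                                       (≡.trans (update-update x B₁) (update-same B₁ x∈)) ⟨
      p (S [ x ]≔ false) * p (T [ x ]≔ true)
        ≈⟨ Pl-isolate (p ⊗ p) (λ _ _ → 0#) S T x
             (trans (pluckerSum≈0⇒Pl≈0 S T size-S size-T (plücker S T size-S size-T))
                    (sym (Pl-0 (λ _ _ → refl) S T)))
             (lookup∘update x B₂ true) (lookup∘update x B₁ false)
             (λ y y≢x y∈S y∉T → trans (*-congˡ (none y (lookup-insert B₂ y∈S y≢x)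
               (≡.trans (≡.sym (lookup∘update′ y≢x B₁ false)) y∉T))) (zeroʳ _)) ⟩
      0# ∎

  strong⇒weak : StrongPMatroid r p → WeakPMatroid r p
  strong⇒weak (_ , plücker) = point , (λ S T size-S size-T _ → plücker S T size-S size-T) , record
    { nonempty = proj₂ point
    ; rank     = λ _ → proj₁
    ; exchange = strong⇒exchange plücker
    }

  -- The signs are chosen so that row b ∧ p vanishes at B ∪ {x}.
  module Coordinates (B : Subset n) (size-B : ∣ B ∣ ≡ r) (pB : G (p B)) where

    row : Fin n → Fin n → Carrier
    row b x with b ≟ x | lookup B x
    ... | yes _ | _     = p B
    ... | no _  | true  = 0#
    ... | no _  | false =
      - (ε (B [ x ]≔ true) b * (ε (B [ x ]≔ true) x * p ((B [ b ]≔ false) [ x ]≔ true)))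

    row-diagonal : ∀ b → row b b ≡ p B
    row-diagonal b with b ≟ b
    ... | yes _  = ≡.refl
    ... | no b≢b = contradiction ≡.refl b≢b

    row-∈ : ∀ {b x} → b ≢ x → lookup B x ≡ true → row b x ≡ 0#
    row-∈ {b} {x} b≢x x∈B with b ≟ x | lookup B x
    row-∈ b≢x x∈B    | yes b≡x | _    = contradiction b≡x b≢x
    row-∈ b≢x ≡.refl | no _    | true = ≡.refl

    row-∉ : ∀ {b x} → b ≢ x → lookup B x ≡ false → row b x ≡
      - (ε (B [ x ]≔ true) b * (ε (B [ x ]≔ true) x * p ((B [ b ]≔ false) [ x ]≔ true)))
    row-∉ {b} {x} b≢x x∉B with b ≟ x | lookup B x
    row-∉ b≢x x∉B    | yes b≡x | _     = contradiction b≡x b≢x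
    row-∉ b≢x ≡.refl | no _    | false = ≡.refl

    size-neighbour : ∀ b x → lookup B b ≡ true → lookup B x ≡ false → ∣ (B [ b ]≔ false) [ x ]≔ true ∣ ≡ r
    size-neighbour b x b∈B x∉B = ≡.trans
      (∣insert∣ (B [ b ]≔ false) (≡.trans (lookup∘update′ (lookup-separates B b∈B x∉B ∘ ≡.sym) B false) x∉B))
      (≡.trans (∣delete∣ B b∈B) size-B)

    row-InP : ∀ b x → lookup B b ≡ true → InP (row b x)
    row-InP b x b∈B with b ≟ x | lookup B x in eq
    ... | yes _ | _     = inj₁ pB
    ... | no _  | true  = inj₂ refl
    ... | no _  | false = InP-neg (InP-mul
      (inj₁ (ε-∈ (B [ x ]≔ true) b (insert-lookup B b∈B)))
      (InP-mul (inj₁ (ε-∈ (B [ x ]≔ true) x (lookup∘update x B true)))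
        (proj₁ point _ (size-neighbour b x b∈B eq))))

    index : Fin r → Fin n
    index i = elems B (≡.subst Fin (≡.sym size-B) i)

    index-surjective : ∀ b → lookup B b ≡ true → Σ (Fin r) λ i → index i ≡ b
    index-surjective b b∈B with k , eq ← elems-surjective B b b∈B
      = ≡.subst Fin size-B k , ≡.trans (≡.cong (elems B) (≡.subst-sym-subst size-B)) eq

    A : Fin r → Fin n → Carrier
    A i = row (index i)

    q : Subset n → Carrier
    q = wedge A

    -- On the columns of `B` the matrix is `p B` times the identity. Having `p B` on the diagonal
    -- rather than 1 keeps division out of the entries.
    qB : G (q B)
    qB = G-resp (det≈wedge A B size-B) (det-diagonal (subMatrix A B size-B)
      (λ i → ≡.subst G (≡.sym (row-diagonal (index i))) pB)
      (λ i k i≢k → reflexive (row-∈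
        (i≢k ∘ subst-injective (≡.sym size-B) ∘ elems-injective B) (elems-∈ B _))))

    -- `row b` is one of the rows of `A`, so its wedge with `q` vanishes at `S`. Within `S` the row
    -- is nonzero at most at `b` and `x`, which leaves a two-term relation between `q K` and `q B`;
    -- its coefficient at `x` is `p K` up to sign.
    neighbour : ∀ b x → lookup B b ≡ true → lookup B x ≡ false →
      q B * p ((B [ b ]≔ false) [ x ]≔ true) ≈ p B * q ((B [ b ]≔ false) [ x ]≔ true)
    neighbour b x b∈B x∉B = G-cancelˡ (ε-∈ S b b∈S) (begin
      εb * (q B * p K)
        ≈⟨ *-identityˡ _ ⟨
      1# * (εb * (q B * p K))
        -- Inserting the square of `εx` recreates the entry `row b x`, one `εx` going into the entry
        -- and one serving as its sign in the expansion.
        ≈⟨ *-congʳ (ε-square S x x∈S) ⟨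
      (εx * εx) * (εb * (q B * p K))
        ≈⟨ solve 4 (λ x b q p → (x :* x) :* (b :* (q :* p)) := :- (x :* ((:- (b :* (x :* p))) :* q))) refl _ _ _ _ ⟩
      - (εx * (- (εb * (εx * p K)) * q B))
        ≈⟨ inverseʳ-unique _ _ (trans (+-comm _ _) two-terms) ⟨
      εb * (p B * q K) ∎)
      where
      S = B [ x ]≔ true
      K = (B [ b ]≔ false) [ x ]≔ true
      εb = ε S b
      εx = ε S x
      b∈S = insert-lookup B b∈B
      x∈S = lookup∘update x B true
      b≢x = lookup-separates B b∈B x∉B
      term = λ y → ε S y * (row b y * q (S [ y ]≔ false))
      rest : ∀ y s → lookup B y ≡ s → y ≢ b → y ≢ x → term y ≈ 0#
      rest y true  eq y≢b _   =
        trans (*-congˡ (trans (*-congʳ (reflexive (row-∈ (y≢b ∘ ≡.sym) eq))) (zeroˡ _))) (zeroʳ _)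
      rest y false eq _   y≢x =
        trans (*-congʳ (ε-∉ S y (≡.trans (lookup∘update′ y≢x B true) eq))) (zeroˡ _)
      row∧q : W (row b) q S ≈ 0#
      row∧q with i , eq ← index-surjective b b∈B = ≡.subst (λ z → W (row z) q S ≈ 0#) eq (row∧wedge A i S)
      two-terms : εb * (p B * q K) + εx * (- (εb * (εx * p K)) * q B) ≈ 0#
      two-terms = begin
        εb * (p B * q K) + εx * (- (εb * (εx * p K)) * q B)
          ≡⟨ ≡.cong₂ _+_
               (≡.cong₂ (λ u L → εb * (u * q L)) (row-diagonal b) (update-comm B (b≢x ∘ ≡.sym)))
               (≡.cong₂ (λ u L → εx * (u * q L)) (row-∉ b≢x x∉B)
                 (≡.trans (update-update x B) (update-same B x∉B))) ⟨
        term b + term x  ≈⟨ sum-pair b≢x (λ y → rest y _ ≡.refl) ⟨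
        _                ≈⟨ W-expand (row b) q S ⟨
        W (row b) q S    ≈⟨ row∧q ⟩
        0#               ∎

  weak⇒representable : WeakPMatroid r p → Representable r p
  weak⇒representable (_ , plücker3 , matroid) with B , size-B , pB≉0 ← proj₂ point
    = A , (λ i x → row-InP (index i) x (elems-∈ B _)) , q B * pB⁻¹ , G-mul qB GpB⁻¹ , coordinate
    where
    pB = ≉0⇒G (proj₁ point B size-B) pB≉0
    open Coordinates B size-B pB
    pB⁻¹ = proj₁ (G-inv pB)
    GpB⁻¹ = proj₁ (proj₂ (G-inv pB))
    -- Cross-multiplied so that the two vectors agree at `B` by commutativity and at its neighbours
    -- by `neighbour`. Dividing by `p B` at the end gives the scalar `q B * pB⁻¹`.
    p̂ q̂ : Subset n → Carrier
    p̂ J = q B * p J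
    q̂ J = p B * q J

    Pl-scale : ∀ k f S T → Pl (f ⊗ f) S T ≈ 0# → Pl ((λ J → k * f J) ⊗ (λ J → k * f J)) S T ≈ 0#
    Pl-scale k f S T eq = begin
      Pl ((λ J → k * f J) ⊗ (λ J → k * f J)) S T
        ≈⟨ Pl-cong (λ S T → solve 3 (λ k x y → (k :* x) :* (k :* y) := (k :* k) :* (x :* y)) refl k (f S) (f T)) S T ⟩
      Pl (λ S T → (k * k) * (f ⊗ f) S T) S T ≈⟨ Pl-* (k * k) (f ⊗ f) S T ⟩
      (k * k) * Pl (f ⊗ f) S T               ≈⟨ *-congˡ eq ⟩
      (k * k) * 0#                           ≈⟨ zeroʳ _ ⟩
      0#                                     ∎

    exchange : ∀ J → ∣ J ∣ ≡ r → G (p̂ J) → ∀ x → lookup J x ≡ true → lookup B x ≡ false →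
      Σ (Fin n) λ y → lookup B y ≡ true × lookup J y ≡ false × G (p̂ ((J [ x ]≔ false) [ y ]≔ true))
    exchange J size Gp̂J x x∈J x∉B
      with y , y∈B , y∉J , supp ← IsMatroidBases.exchange matroid J B
             (size , λ pJ≈0 → G≉0 Gp̂J (trans (*-congˡ pJ≈0) (zeroʳ _))) (size-B , pB≉0)
             x (lookup⇒[]= x J x∈J) (lookup⇒∉ x∉B)
      with size′ , p≉0 ← ≡.subst (support r p)
             (≡.trans (∪≡insert (J - x) y) (≡.cong (_[ y ]≔ true) (-≡delete J x))) supp
      = y , []=⇒lookup y∈B , ∉⇒lookup y∉J , G-mul qB (≉0⇒G (proj₁ point _ size′) p≉0)

    p̂≈q̂ : ∀ J → ∣ J ∣ ≡ r → p̂ J ≈ q̂ J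
    p̂≈q̂ = Agreement.agree P r p̂ q̂ B size-B G≉0
      (λ J size → InP-mul (inj₁ qB) (proj₁ point J size))
      exchange
      (λ S T size-S size-T three → Pl-scale (q B) p S T
        (pluckerSum≈0⇒Pl≈0 S T size-S size-T (plücker3 S T size-S size-T three)))
      (λ S T → Pl-scale (p B) q S T (Pl-wedge A S T))
      (G-mul qB pB) (*-comm _ _) neighbour

    coordinate : ∀ J (eq : ∣ J ∣ ≡ r) → (q B * pB⁻¹) * p J ≈ det (subMatrix A J eq)
    coordinate J size = trans (G-cancelˡ pB (begin
      p B * ((q B * pB⁻¹) * p J)
        ≈⟨ solve 4 (λ b u i x → b :* ((u :* i) :* x) := (b :* i) :* (u :* x)) refl _ _ _ _ ⟩
      (p B * pB⁻¹) * (q B * p J) ≈⟨ *-congʳ (proj₂ (proj₂ (G-inv pB))) ⟩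
      1# * (q B * p J)           ≈⟨ *-identityˡ _ ⟩
      q B * p J                  ≈⟨ p̂≈q̂ J size ⟩
      p B * q J                  ∎)) (sym (det≈wedge A J size))

theorem2p6 : ∀ {c ℓ g} (P : PartialField c ℓ g) (n r : ℕ) → r ≤ n →
    (p : Subset n → PartialField.Carrier P) → PF.IsPoint P r p →
    (PF.Representable P r p ⇔ PF.StrongPMatroid P r p) ×
    (PF.StrongPMatroid P r p ⇔ PF₂.WeakPMatroid P r p)
theorem2p6 P n r _ p point =
  -- Each missing converse is obtained by going round the cycle representable, strong, weak,
  -- representable.
  mk⇔ representable⇒strong (weak⇒representable ∘ strong⇒weak) ,
  mk⇔ strong⇒weak (representable⇒strong ∘ weak⇒representable)
  where open Equivalences P p point
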